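{- Let $d\geq 4$ be an even integer and let $n$ be an integer with $n\equiv -1 \pmod d$ and $n\geq 2d-1$. Then \[ \sum_{k=0}^{n-1}\frac{(q^{d+1};q^d)_k^{d-1}(q^{1-d};q^d)_k\,q^{dk}}{(q^d;q^d)_k^d} \equiv \frac{(1-q)(1-q^{d-1})(q^d;q^d)_{n-1-(n+1)/d}}{ -(-1)^{(n+1)/d}(q^d;q^d)_{(n+1)/d}^{d-1}}\,q^{(d(d+n)(n+1)-(n+1)^2)/(2d)-1}\pmod{\Phi_n(q)^2}. \]
   Context: For a complex variable $x$ and integer $m\ge 0$, $(x;q)_\infty=\prod_{j\ge0}(1-xq^j)$ and $(x;q)_m=(x;q)_\infty/(xq^m;q)_\infty=(1-x)(1-xq)\cdots(1-xq^{m-1})$, with $(x;q)_0=1$; also $(x;q)_m^e$ denotes the $e$-th power of $(x;q)_m$. $\Phi_n(q)$ is the $n$-th cyclotomic polynomial. For rational functions $A(q),B(q)$ and a polynomial $P(q)$, $A\equiv B\pmod{P(q)}$ means that $(A-B)/P$ is a rational function whose denominator is coprime to $P(q)$. -}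

module Defs where

open import Data.Nat as ℕ using (ℕ; zero; suc; _∸_)
open import Data.Nat.Divisibility using (_∣?_)
open import Data.Integer as ℤ using (ℤ; +_; -[1+_])
open import Data.List using (List; []; _∷_; _++_; map; foldr; upTo; filter; replicate)
open import Data.Product using (_×_; _,_; proj₁; proj₂; ∃; ∃-syntax)
open import Relation.Binary.PropositionalEquality using (_≡_; _≢_)

-- Polynomials in q with integer coefficients, as coefficient lists
-- (lowest degree first).  Trailing zeros are allowed; equality is
-- coefficientwise (_≈ₚ_).

Poly : Set
Poly = List ℤ

infixl 6 _+ₚ_ _-ₚ_
infixl 7 _*ₚ_

_+ₚ_ : Poly → Poly → Poly
[]      +ₚ q       = q
(a ∷ p) +ₚ []      = a ∷ p
(a ∷ p) +ₚ (b ∷ q) = (a ℤ.+ b) ∷ (p +ₚ q)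

negₚ : Poly → Poly
negₚ = map (λ x → ℤ.- x)

_-ₚ_ : Poly → Poly → Poly
p -ₚ q = p +ₚ negₚ q

_*ₚ_ : Poly → Poly → Poly
[]      *ₚ q = []
(a ∷ p) *ₚ q = map (a ℤ.*_) q +ₚ (+ 0 ∷ (p *ₚ q))

constₚ : ℤ → Poly
constₚ c = c ∷ []

oneₚ : Poly
oneₚ = constₚ (+ 1)

X^ : ℕ → Poly
X^ k = replicate k (+ 0) ++ (+ 1 ∷ [])

coeff : Poly → ℕ → ℤ
coeff []      _       = + 0
coeff (a ∷ p) zero    = a
coeff (a ∷ p) (suc i) = coeff p i

infix 4 _≈ₚ_
_≈ₚ_ : Poly → Poly → Set
p ≈ₚ q = ∀ i → coeff p i ≡ coeff q i

prodₚ : List Poly → Poly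
prodₚ = foldr _*ₚ_ oneₚ

sumℤ : List ℤ → ℤ
sumℤ = foldr ℤ._+_ (+ 0)

-- Cyclotomic polynomials, via  q^n - 1 = ∏_{e ∣ n} Φ_e(q).
-- Φ_n is the exact quotient of q^n - 1 by ∏_{e ∣ n, e < n} Φ_e.
-- The quotient is computed by power-series division by D, whose constant
-- term is ±1 (so d₀⁻¹ = d₀); since deg Φ_n ≤ n, the first n+1 series
-- coefficients give Φ_n exactly.

-- first L coefficients of the power series N / D (assuming D(0) = ±1)
seriesDiv : Poly → Poly → ℕ → Poly
seriesDiv N D zero    = []
seriesDiv N D (suc i) =
  let prev = seriesDiv N D i
      s    = sumℤ (map (λ j → coeff D (suc j) ℤ.* coeff prev (i ∸ suc j)) (upTo i))
  in prev ++ (coeff D 0 ℤ.* (coeff N i ℤ.- s) ∷ [])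

properDivisors : ℕ → List ℕ
properDivisors n = filter (λ e → e ∣? n) (map suc (upTo (n ∸ 1)))

cycloF : ℕ → ℕ → Poly
cycloF zero     n = []
cycloF (suc f)  n =
  seriesDiv (X^ n -ₚ oneₚ) (prodₚ (map (cycloF f) (properDivisors n))) (suc n)

Φ : ℕ → Poly
Φ n = cycloF (suc n) n

RF : Set
RF = Poly × Poly

infixl 6 _+ᵣ_
infixl 7 _*ᵣ_

_+ᵣ_ : RF → RF → RF
(a , b) +ᵣ (c , d) = (a *ₚ d +ₚ c *ₚ b , b *ₚ d)

_*ᵣ_ : RF → RF → RF
(a , b) *ᵣ (c , d) = (a *ₚ c , b *ₚ d)

invᵣ : RF → RF
invᵣ (a , b) = (b , a)

_/ᵣ_ : RF → RF → RF
x /ᵣ y = x *ᵣ invᵣ y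

oneᵣ : RF
oneᵣ = (oneₚ , oneₚ)

polyᵣ : Poly → RF
polyᵣ p = (p , oneₚ)

_^ᵣ_ : RF → ℕ → RF
x ^ᵣ zero  = oneᵣ
x ^ᵣ suc k = x *ᵣ (x ^ᵣ k)

sumᵣ : List RF → RF
sumᵣ = foldr _+ᵣ_ (constₚ (+ 0) , oneₚ)

prodᵣ : List RF → RF
prodᵣ = foldr _*ᵣ_ oneᵣ

oneMinusQ : ℤ → RF
oneMinusQ (+ e)      = (oneₚ -ₚ X^ e , oneₚ)
oneMinusQ -[1+ m ]   = (X^ (suc m) -ₚ oneₚ , X^ (suc m))

qPoch : ℤ → ℕ → ℕ → RF
qPoch a s k = prodᵣ (map (λ j → oneMinusQ (a ℤ.+ + (s ℕ.* j))) (upTo k))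

-- Coprimality in ℚ[q] (gcd = 1), written over ℤ[q] after clearing
-- denominators: S V + T P = c for some nonzero integer c.

CoprimeP : Poly → Poly → Set
CoprimeP V P = ∃[ S ] ∃[ T ] ∃[ c ] (c ≢ + 0 × (S *ₚ V +ₚ T *ₚ P ≈ₚ constₚ c))

-- A ≡ B (mod P): (A - B)/P = U/V with V coprime to P.
-- For A = a₁/a₂, B = b₁/b₂:  (A - B)/P = (a₁ b₂ - b₁ a₂) / (P a₂ b₂).
infix 4 _≡ᵣ_[mod_]
_≡ᵣ_[mod_] : RF → RF → Poly → Set
(a₁ , a₂) ≡ᵣ (b₁ , b₂) [mod P ] =
  ∃[ U ] ∃[ V ] (CoprimeP V P ×
    ((a₁ *ₚ b₂ -ₚ b₁ *ₚ a₂) *ₚ V ≈ₚ (P *ₚ a₂ *ₚ b₂) *ₚ U))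

lhs : ℕ → ℕ → RF
lhs d n = sumᵣ (map term (upTo n))
  where
  term : ℕ → RF
  term k = ((qPoch (+ (suc d)) d k ^ᵣ (d ∸ 1))
            *ᵣ qPoch (+ 1 ℤ.- + d) d k
            *ᵣ polyᵣ (X^ (d ℕ.* k)))
           /ᵣ (qPoch (+ d) d k ^ᵣ d)

-- (1-q)(1-q^{d-1}) (q^d;q^d)_{n-1-m} q^E / ( -(-1)^m (q^d;q^d)_m^{d-1} ),
-- with m = (n+1)/d and E the given exponent
rhs : ℕ → ℕ → ℕ → ℕ → RF
rhs d n m E =
  (oneMinusQ (+ 1) *ᵣ oneMinusQ (+ (d ∸ 1)) *ᵣ qPoch (+ d) d (n ∸ 1 ∸ m) *ᵣ polyᵣ (X^ E))
  /ᵣ (polyᵣ (constₚ (ℤ.- (ℤ.-1ℤ ℤ.^ m))) *ᵣ (qPoch (+ d) d m ^ᵣ (d ∸ 1)))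

{-# OPTIONS --safe #-}
module Submission where

-- Put p = q^d and N = n - 1 - m. Since q^n ≡ 1 - ε with ε² ≡ 0 modulo Φ_n(q)², a product of factors
-- 1 - x q^{c n} depends, to this order, only on the sum of the exponents c. As d m = n + 1, the d - 1 factors
-- (q^{d+1}; p)_k can therefore be replaced by (p^{-N}; p)_k, (p^{m+1} q^n; p)_k and d - 3 copies of (p^{m+1}; p)_k,
-- and the denominators (p; p)_k² by (p q^n; p)_k (p q^{-n}; p)_k. The new summand is the k-th coefficient of
-- ∏_{i<N} (1 - p^{-i} t) times a polynomial in p^k of degree N, so that summation extracts the leading coefficient
-- of that polynomial (a Karlsson–Minton sum), and this is the right-hand side.

open import Defs
open import Level using (0ℓ; _⊔_)
open import Algebra using (CommutativeRing)
import Algebra.Properties.CommutativeSemiring.Exp as Powers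
import Algebra.Properties.Ring as RingProperties
import Algebra.Properties.Semiring.Mult.TCOptimised as Multiples
import Algebra.Solver.Ring as RingSolver
open import Algebra.Solver.Ring.AlmostCommutativeRing using (fromCommutativeRing; _-Raw-AlmostCommutative⟶_)
open import Data.Integer as ℤ using (ℤ; +_; -[1+_])
import Data.Integer.Properties as ℤₚ
open import Data.Integer.Tactic.RingSolver using (solve-∀)
open import Data.List using (List; []; _∷_; _++_; map; upTo; applyUpTo; filter; length)
import Data.List.Properties as Listₚ
open import Data.List.Relation.Unary.All as All using (All; []; _∷_)
import Data.List.Relation.Unary.All.Properties as Allₚ
open import Data.Maybe as Maybe using (Maybe)
open import Data.Nat as ℕ using (ℕ; zero; suc; s≤s; z≤n; _∸_)
open import Data.Nat.Divisibility using (_∣_; _∣?_; divides; ∣-refl; ∣-trans; ∣⇒≤; ∣m+n∣m⇒∣n; ∣n⇒∣m*n; m∣m*n)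
open import Data.Nat.DivMod using (m*n/n≡m)
open import Data.Nat.GCD using (gcd; gcd-GCD; gcd[m,n]∣m; gcd[m,n]∣n; module Bézout)
open import Data.Nat.Induction using (<-rec)
import Data.Nat.Properties as ℕₚ
open import Data.Nat.Tactic.RingSolver using () renaming (solve-∀ to solve-∀ℕ)
open import Data.Product using (_×_; _,_; proj₁; proj₂; ∃-syntax)
open import Data.Sum using (inj₁; inj₂; [_,_]′)
open import Function using (_∘_)
import Relation.Binary.PropositionalEquality as ≡
open ≡ using (_≡_; _≢_)
import Relation.Binary.Reasoning.Setoid as SetoidReasoning
open import Relation.Nullary using (¬_; Dec; yes; no; contradiction)
open import Relation.Nullary.Decidable using (dec⇒maybe)

-- The congruence becomes an equation: fractions with denominators coprime to Φ_n², taken modulo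
-- Φ_n², form a commutative ring in which q is invertible, 1 - q^n squares to zero, and 1 - p^i is
-- invertible for 0 < i < n, because d m = n + 1 makes d prime to n. The shifts c have to sum to
-- zero. The degrees (d-3)m + m + (m-2) add up to exactly N, so only the leading coefficient is
-- seen. The other obstacle is Φ_n itself, given as a truncated power series quotient: that it
-- divides q^n - 1 has to be proved, by strong induction and together with coprimality of the Φ_e.
-- Over ℤ[q] coprimality yields only a nonzero integer, hence the constants carried along.

module IntegerSolver {c ℓ} (R : CommutativeRing c ℓ) where
  open CommutativeRing R
  open RingProperties ring
  open Multiples semiring renaming (_×_ to _×′_)
  open SetoidReasoning setoid

  -- Integer coefficients have decidable equality, so with this homomorphism the solver can
  -- normalise numerals in any commutative ring.
  fromℤ : ℤ → Carrier
  fromℤ (+ n)    = n ×′ 1#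
  fromℤ -[1+ n ] = - (suc n ×′ 1#)

  fromℤ-⊖ : ∀ m n → fromℤ (m ℤ.⊖ n) ≈ m ×′ 1# + - (n ×′ 1#)
  fromℤ-⊖ m       zero    = sym (trans (+-congˡ -0#≈0#) (+-identityʳ _))
  fromℤ-⊖ zero    (suc n) = sym (+-identityˡ _)
  fromℤ-⊖ (suc m) (suc n) = begin
    fromℤ (suc m ℤ.⊖ suc n)                    ≡⟨ ≡.cong fromℤ (ℤₚ.[1+m]⊖[1+n]≡m⊖n m n) ⟩
    fromℤ (m ℤ.⊖ n)                            ≈⟨ fromℤ-⊖ m n ⟩
    m ×′ 1# + - (n ×′ 1#)                      ≈⟨ +-congʳ (+-identityˡ _) ⟨
    (0# + m ×′ 1#) + - (n ×′ 1#)               ≈⟨ +-congʳ (+-congʳ (-‿inverseʳ 1#)) ⟨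
    ((1# + - 1#) + m ×′ 1#) + - (n ×′ 1#)      ≈⟨ +-congʳ (+-assoc _ _ _) ⟩
    (1# + (- 1# + m ×′ 1#)) + - (n ×′ 1#)      ≈⟨ +-congʳ (+-congˡ (+-comm _ _)) ⟩
    (1# + (m ×′ 1# + - 1#)) + - (n ×′ 1#)      ≈⟨ +-congʳ (+-assoc _ _ _) ⟨
    ((1# + m ×′ 1#) + - 1#) + - (n ×′ 1#)      ≈⟨ +-assoc _ _ _ ⟩
    (1# + m ×′ 1#) + (- 1# + - (n ×′ 1#))      ≈⟨ +-cong (1+× m 1#) (sym (-‿+-comm 1# _)) ⟨
    suc m ×′ 1# + - (1# + n ×′ 1#)             ≈⟨ +-congˡ (-‿cong (1+× n 1#)) ⟨
    suc m ×′ 1# + - (suc n ×′ 1#)              ∎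

  fromℤ-+ : ∀ i j → fromℤ (i ℤ.+ j) ≈ fromℤ i + fromℤ j
  fromℤ-+ (+ m)    (+ n)    = ×-homo-+ 1# m n
  fromℤ-+ (+ m)    -[1+ n ] = fromℤ-⊖ m (suc n)
  fromℤ-+ -[1+ m ] (+ n)    = trans (fromℤ-⊖ n (suc m)) (+-comm _ _)
  fromℤ-+ -[1+ m ] -[1+ n ] = begin
    - (suc (suc (m ℕ.+ n)) ×′ 1#)              ≈⟨ -‿cong (trans (1+× (suc (m ℕ.+ n)) 1#) (+-congˡ (×-homo-+ 1# (suc m) n))) ⟩
    - (1# + (suc m ×′ 1# + n ×′ 1#))           ≈⟨ -‿cong (trans (sym (+-assoc _ _ _)) (trans (+-congʳ (+-comm _ _)) (+-assoc _ _ _))) ⟩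
    - (suc m ×′ 1# + (1# + n ×′ 1#))           ≈⟨ -‿+-comm _ _ ⟨
    - (suc m ×′ 1#) + - (1# + n ×′ 1#)         ≈⟨ +-congˡ (-‿cong (1+× n 1#)) ⟨
    - (suc m ×′ 1#) + - (suc n ×′ 1#)          ∎

  fromℤ-neg : ∀ i → fromℤ (ℤ.- i) ≈ - fromℤ i
  fromℤ-neg (+ zero)  = sym -0#≈0#
  fromℤ-neg (+ suc n) = refl
  fromℤ-neg -[1+ n ]  = sym (-‿involutive _)

  fromℤ-+* : ∀ m n → fromℤ (+ m ℤ.* + n) ≈ fromℤ (+ m) * fromℤ (+ n)
  fromℤ-+* m n = trans (reflexive (≡.cong fromℤ (≡.sym (ℤₚ.pos-* m n)))) (×1-homo-* m n)

  fromℤ-* : ∀ i j → fromℤ (i ℤ.* j) ≈ fromℤ i * fromℤ j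
  fromℤ-* (+ m)    (+ n)    = fromℤ-+* m n
  fromℤ-* (+ m)    -[1+ n ] = begin
    fromℤ (+ m ℤ.* -[1+ n ])              ≡⟨ ≡.cong fromℤ (ℤₚ.neg-distribʳ-* (+ m) (+ suc n)) ⟨
    fromℤ (ℤ.- (+ m ℤ.* + suc n))         ≈⟨ fromℤ-neg (+ m ℤ.* + suc n) ⟩
    - fromℤ (+ m ℤ.* + suc n)             ≈⟨ -‿cong (fromℤ-+* m (suc n)) ⟩
    - (m ×′ 1# * (suc n ×′ 1#))           ≈⟨ -‿distribʳ-* _ _ ⟩
    m ×′ 1# * - (suc n ×′ 1#)             ∎
  fromℤ-* -[1+ m ] (+ n)    = begin
    fromℤ (-[1+ m ] ℤ.* + n)              ≡⟨ ≡.cong fromℤ (ℤₚ.neg-distribˡ-* (+ suc m) (+ n)) ⟨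
    fromℤ (ℤ.- (+ suc m ℤ.* + n))         ≈⟨ fromℤ-neg (+ suc m ℤ.* + n) ⟩
    - fromℤ (+ suc m ℤ.* + n)             ≈⟨ -‿cong (fromℤ-+* (suc m) n) ⟩
    - (suc m ×′ 1# * (n ×′ 1#))           ≈⟨ -‿distribˡ-* _ _ ⟩
    - (suc m ×′ 1#) * (n ×′ 1#)           ∎
  fromℤ-* -[1+ m ] -[1+ n ] = begin
    fromℤ (+ suc m ℤ.* + suc n)           ≈⟨ fromℤ-+* (suc m) (suc n) ⟩
    suc m ×′ 1# * (suc n ×′ 1#)           ≈⟨ -‿involutive _ ⟨
    - - (suc m ×′ 1# * (suc n ×′ 1#))     ≈⟨ -‿cong (-‿distribˡ-* _ _) ⟩
    - (- (suc m ×′ 1#) * (suc n ×′ 1#))   ≈⟨ -‿distribʳ-* _ _ ⟩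
    - (suc m ×′ 1#) * - (suc n ×′ 1#)     ∎

  ℤ-morphism : CommutativeRing.rawRing ℤₚ.+-*-commutativeRing -Raw-AlmostCommutative⟶ fromCommutativeRing R
  ℤ-morphism = record
    { ⟦_⟧    = fromℤ
    ; +-homo = fromℤ-+
    ; *-homo = fromℤ-*
    ; -‿homo = fromℤ-neg
    ; 0-homo = refl
    ; 1-homo = refl
    }

  _≟′_ : ∀ i j → Maybe (fromℤ i ≈ fromℤ j)
  i ≟′ j = Maybe.map (λ i≡j → reflexive (≡.cong fromℤ i≡j)) (dec⇒maybe (i ℤ.≟ j))

  open RingSolver (CommutativeRing.rawRing ℤₚ.+-*-commutativeRing) (fromCommutativeRing R) ℤ-morphism _≟′_ public
    using (solve; _:+_; _:*_; _:-_; :-_; _:=_; con)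

module OverRing {c ℓ} (R : CommutativeRing c ℓ) where
  open CommutativeRing R
  open IntegerSolver R
  open SetoidReasoning setoid

  -- Fractions modulo a ring element

  module Coprimality {p} (C : Carrier → Set p) (C-1 : C 1#) (C-* : ∀ {x y} → C x → C y → C (x * y)) where

    -- A Bézout relation up to an element of `C`: this is coprimality over the field of rational
    -- coefficients, expressed without leaving integral ones.
    Coprime : Carrier → Carrier → Set (c ⊔ ℓ ⊔ p)
    Coprime V W = ∃[ S ] ∃[ T ] ∃[ e ] (C e × (S * V + T * W ≈ e))

    abstract
      Coprime-sym : ∀ {V W} → Coprime V W → Coprime W V
      Coprime-sym (S , T , e , Ce , eq) = T , S , e , Ce , trans (+-comm _ _) eq

      Coprime-1 : ∀ {W} → Coprime 1# W
      Coprime-1 {W} = 1# , 0# , 1# , C-1 ,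
        solve 1 (λ w → con (+ 1) :* con (+ 1) :+ con (+ 0) :* w := con (+ 1)) refl W

      Coprime-* : ∀ {V₁ V₂ W} → Coprime V₁ W → Coprime V₂ W → Coprime (V₁ * V₂) W
      Coprime-* {V₁} {V₂} {W} (S , T , e , Ce , eq) (S′ , T′ , e′ , Ce′ , eq′) =
        S * S′ , S * V₁ * T′ + T * (S′ * V₂ + T′ * W) , e * e′ , C-* Ce Ce′ ,
        trans
          (solve 7 (λ s t s′ t′ v₁ v₂ w →
              s :* s′ :* (v₁ :* v₂) :+ (s :* v₁ :* t′ :+ t :* (s′ :* v₂ :+ t′ :* w)) :* w
              := (s :* v₁ :+ t :* w) :* (s′ :* v₂ :+ t′ :* w))
            refl S T S′ T′ V₁ V₂ W)
          (*-cong eq eq′)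

      Coprime-∣ : ∀ {V V′ W} K → V * K ≈ V′ → Coprime V′ W → Coprime V W
      Coprime-∣ {V} {V′} {W} K VK≈V′ (S , T , e , Ce , eq) =
        S * K , T , e , Ce , trans
          (trans (solve 5 (λ s t v k w → s :* k :* v :+ t :* w := s :* (v :* k) :+ t :* w) refl S T V K W)
                 (+-congʳ (*-congˡ VK≈V′)))
          eq

      Coprime-congˡ : ∀ {V V′ W} → V ≈ V′ → Coprime V′ W → Coprime V W
      Coprime-congˡ V≈V′ = Coprime-∣ 1# (trans (*-identityʳ _) V≈V′)

      Coprime-C : ∀ {e W} → C e → Coprime e W
      Coprime-C {e} {W} Ce = 1# , 0# , e , Ce , solve 2 (λ e w → con (+ 1) :* e :+ con (+ 0) :* w := e) refl e W

      Coprime-swap : ∀ {x y W} → Coprime (y + - x) W → Coprime (x + - y) W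
      Coprime-swap {x} {y} = Coprime-∣ (- 1#) (solve 2 (λ x y → (x :- y) :* (:- con (+ 1)) := y :- x) refl x y)

      Coprime-square : ∀ {V W} → Coprime V W → Coprime V (W * W)
      Coprime-square V~W = Coprime-sym (Coprime-* (Coprime-sym V~W) (Coprime-sym V~W))

  -- C plays the role of the nonzero constants; up to them, _≃_ is _≡ᵣ_[mod P ].
  module FractionRing {p} (C : Carrier → Set p) (C-1 : C 1#) (C-* : ∀ {x y} → C x → C y → C (x * y)) (P : Carrier) where

    open Coprimality C C-1 C-*

    -- The underlying pair is never reduced, and the operations below act on it exactly as `_+ᵣ_`
    -- and `_*ᵣ_` do. Hence `frac` of a ring expression can be literally the `RF` of the statement.
    record Fraction : Set (c ⊔ ℓ ⊔ p) where
      no-eta-equality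
      constructor mkFraction
      field
        frac    : Carrier × Carrier
        coprime : Coprime (proj₂ frac) P
      num den : Carrier
      num = proj₁ frac
      den = proj₂ frac

    open Fraction public

    -- Divisibility by `P` once the constants are inverted; `e` clears the denominators of the
    -- quotient.
    Vanishes : Carrier → Set (c ⊔ ℓ ⊔ p)
    Vanishes x = ∃[ e ] ∃[ U ] (C e × (e * x ≈ P * U))

    infix 4 _≃_
    record _≃_ (x y : Fraction) : Set (c ⊔ ℓ ⊔ p) where
      constructor vanishing
      field vanishes : Vanishes (num x * den y + - (num y * den x))

    vanishes-cong : ∀ {x y} → x ≈ y → Vanishes x → Vanishes y
    vanishes-cong x≈y (e , U , Ce , eq) = e , U , Ce , trans (*-congˡ (sym x≈y)) eq

    vanishes-* : ∀ {x} y → Vanishes x → Vanishes (y * x)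
    vanishes-* {x} y (e , U , Ce , eq) = e , y * U , Ce ,
      trans (solve 3 (λ e x y → e :* (y :* x) := y :* (e :* x)) refl e x y)
        (trans (*-congˡ eq) (solve 3 (λ p u y → y :* (p :* u) := p :* (y :* u)) refl P U y))

    vanishes-+ : ∀ {x y} → Vanishes x → Vanishes y → Vanishes (x + y)
    vanishes-+ {x} {y} (e , U , Ce , eq) (e′ , U′ , Ce′ , eq′) = e * e′ , e′ * U + e * U′ , C-* Ce Ce′ ,
      trans (solve 4 (λ e e′ x y → e :* e′ :* (x :+ y) := e′ :* (e :* x) :+ e :* (e′ :* y)) refl e e′ x y)
        (trans (+-cong (*-congˡ eq) (*-congˡ eq′))
          (solve 5 (λ e e′ u u′ p → e′ :* (p :* u) :+ e :* (p :* u′) := p :* (e′ :* u :+ e :* u′)) refl e e′ U U′ P))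

    vanishes-0 : ∀ {x} → x ≈ 0# → Vanishes x
    vanishes-0 x≈0 = 1# , 0# , C-1 , trans (*-congˡ x≈0) (trans (zeroʳ 1#) (sym (zeroʳ P)))

    vanishes-neg : ∀ {x} → Vanishes x → Vanishes (- x)
    vanishes-neg {x} v = vanishes-cong (solve 1 (λ x → (:- con (+ 1)) :* x := :- x) refl x) (vanishes-* (- 1#) v)

    -- Multiply the Bézout relation of `b` and `P` by `x`: both terms on its left are then divisible
    -- by `P`. This is what makes `_≃_` transitive.
    vanishes-cancel : ∀ {x} b → Coprime b P → Vanishes (b * x) → Vanishes x
    vanishes-cancel {x} b (S , T , e , Ce , eq) (e′ , U , Ce′ , eq′) =
      e′ * e , S * U + e′ * T * x , C-* Ce′ Ce , (begin
        e′ * e * x                             ≈⟨ *-congʳ (*-congˡ eq) ⟨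
        e′ * (S * b + T * P) * x               ≈⟨ solve 6 (λ e′ s b t p x → e′ :* (s :* b :+ t :* p) :* x
                                                    := s :* (e′ :* (b :* x)) :+ p :* (e′ :* t :* x)) refl e′ S b T P x ⟩
        S * (e′ * (b * x)) + P * (e′ * T * x)  ≈⟨ +-congʳ (*-congˡ eq′) ⟩
        S * (P * U) + P * (e′ * T * x)         ≈⟨ solve 4 (λ s p u y → s :* (p :* u) :+ p :* y := p :* (s :* u :+ y)) refl S P U (e′ * T * x) ⟩
        P * (S * U + e′ * T * x)               ∎)

    cross≃ : ∀ {x y} → num x * den y ≈ num y * den x → x ≃ y
    cross≃ eq = vanishing (vanishes-0 (trans (+-congʳ eq) (-‿inverseʳ _)))

    ≃-refl : ∀ {x} → x ≃ x
    ≃-refl {x} = cross≃ {x} {x} refl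

    ≃-sym : ∀ {x y} → x ≃ y → y ≃ x
    ≃-sym {x} {y} (vanishing v) = vanishing (vanishes-cong
      (solve 4 (λ a b c d → :- (a :* d :- c :* b) := c :* b :- a :* d) refl (num x) (den x) (num y) (den y))
      (vanishes-neg v))

    ≃-trans : ∀ {x y z} → x ≃ y → y ≃ z → x ≃ z
    ≃-trans {x} {y} {z} (vanishing v) (vanishing w) = vanishing (vanishes-cancel (den y) (coprime y) (vanishes-cong
      (solve 6 (λ a b c d e f → f :* (a :* d :- c :* b) :+ b :* (c :* f :- e :* d) := d :* (a :* f :- e :* b)) refl
        (num x) (den x) (num y) (den y) (num z) (den z))
      (vanishes-+ (vanishes-* (den z) v) (vanishes-* (den x) w))))

    infixl 6 _⊕_
    infixl 7 _⊗_

    _⊕_ : Fraction → Fraction → Fraction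
    x ⊕ y = mkFraction (num x * den y + num y * den x , den x * den y) (Coprime-* (coprime x) (coprime y))

    _⊗_ : Fraction → Fraction → Fraction
    x ⊗ y = mkFraction (num x * num y , den x * den y) (Coprime-* (coprime x) (coprime y))

    ⊖_ : Fraction → Fraction
    ⊖ x = mkFraction (- num x , den x) (coprime x)

    0F 1F : Fraction
    0F = mkFraction (0# , 1#) Coprime-1
    1F = mkFraction (1# , 1#) Coprime-1

    ⊕-cong : ∀ {x x′ y y′} → x ≃ x′ → y ≃ y′ → x ⊕ y ≃ x′ ⊕ y′
    ⊕-cong {x} {x′} {y} {y′} (vanishing v) (vanishing w) = vanishing (vanishes-cong
      (solve 8 (λ a b a′ b′ c d c′ d′ →
          d :* d′ :* (a :* b′ :- a′ :* b) :+ b :* b′ :* (c :* d′ :- c′ :* d)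
          := (a :* d :+ c :* b) :* (b′ :* d′) :- (a′ :* d′ :+ c′ :* b′) :* (b :* d))
        refl (num x) (den x) (num x′) (den x′) (num y) (den y) (num y′) (den y′))
      (vanishes-+ (vanishes-* (den y * den y′) v) (vanishes-* (den x * den x′) w)))

    ⊗-cong : ∀ {x x′ y y′} → x ≃ x′ → y ≃ y′ → x ⊗ y ≃ x′ ⊗ y′
    ⊗-cong {x} {x′} {y} {y′} (vanishing v) (vanishing w) = vanishing (vanishes-cong
      (solve 8 (λ a b a′ b′ c d c′ d′ →
          c :* d′ :* (a :* b′ :- a′ :* b) :+ a′ :* b :* (c :* d′ :- c′ :* d)
          := (a :* c) :* (b′ :* d′) :- (a′ :* c′) :* (b :* d))
        refl (num x) (den x) (num x′) (den x′) (num y) (den y) (num y′) (den y′))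
      (vanishes-+ (vanishes-* (num y * den y′) v) (vanishes-* (num x′ * den x) w)))

    ⊖-cong : ∀ {x x′} → x ≃ x′ → ⊖ x ≃ ⊖ x′
    ⊖-cong {x} {x′} (vanishing v) = vanishing (vanishes-cong
      (solve 4 (λ a b a′ b′ → :- (a :* b′ :- a′ :* b) := :- a :* b′ :- :- a′ :* b) refl (num x) (den x) (num x′) (den x′))
      (vanishes-neg v))

    -- The localisation at the elements coprime to `P`, reduced modulo `P`.
    fractionRing : CommutativeRing _ _
    fractionRing = record
      { Carrier = Fraction ; _≈_ = _≃_ ; _+_ = _⊕_ ; _*_ = _⊗_ ; -_ = ⊖_ ; 0# = 0F ; 1# = 1F
      ; isCommutativeRing = record
        { isRing = record
          { +-isAbelianGroup = record
            { isGroup = record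
              { isMonoid = record
                { isSemigroup = record
                  { isMagma = record
                    { isEquivalence = record
                      { refl  = λ {x} → ≃-refl {x}
                      ; sym   = λ {x} {y} → ≃-sym {x} {y}
                      ; trans = λ {x} {y} {z} → ≃-trans {x} {y} {z} }
                    ; ∙-cong = λ {x} {x′} {y} {y′} → ⊕-cong {x} {x′} {y} {y′} }
                  ; assoc = λ x y z → cross≃ {(x ⊕ y) ⊕ z} {x ⊕ (y ⊕ z)} (solve 6 (λ a b c d e f →
                      ((a :* d :+ c :* b) :* f :+ e :* (b :* d)) :* (b :* (d :* f))
                      := (a :* (d :* f) :+ (c :* f :+ e :* d) :* b) :* (b :* d :* f))
                      refl (num x) (den x) (num y) (den y) (num z) (den z)) }
                ; identity =
                    (λ x → cross≃ {0F ⊕ x} {x} (solve 2 (λ a b → (con (+ 0) :* b :+ a :* con (+ 1)) :* b := a :* (con (+ 1) :* b)) refl (num x) (den x)))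
                  , (λ x → cross≃ {x ⊕ 0F} {x} (solve 2 (λ a b → (a :* con (+ 1) :+ con (+ 0) :* b) :* b := a :* (b :* con (+ 1))) refl (num x) (den x))) }
              ; inverse =
                  (λ x → cross≃ {⊖ x ⊕ x} {0F} (solve 2 (λ a b → (:- a :* b :+ a :* b) :* con (+ 1) := con (+ 0) :* (b :* b)) refl (num x) (den x)))
                , (λ x → cross≃ {x ⊕ ⊖ x} {0F} (solve 2 (λ a b → (a :* b :+ :- a :* b) :* con (+ 1) := con (+ 0) :* (b :* b)) refl (num x) (den x)))
              ; ⁻¹-cong = λ {x} {y} → ⊖-cong {x} {y} }
            ; comm = λ x y → cross≃ {x ⊕ y} {y ⊕ x} (solve 4 (λ a b c d →
                (a :* d :+ c :* b) :* (d :* b) := (c :* b :+ a :* d) :* (b :* d)) refl (num x) (den x) (num y) (den y)) }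
          ; *-cong = λ {x} {x′} {y} {y′} → ⊗-cong {x} {x′} {y} {y′}
          ; *-assoc = λ x y z → cross≃ {(x ⊗ y) ⊗ z} {x ⊗ (y ⊗ z)} (solve 6 (λ a b c d e f →
              (a :* c :* e) :* (b :* (d :* f)) := (a :* (c :* e)) :* (b :* d :* f))
              refl (num x) (den x) (num y) (den y) (num z) (den z))
          ; *-identity =
              (λ x → cross≃ {1F ⊗ x} {x} (solve 2 (λ a b → con (+ 1) :* a :* b := a :* (con (+ 1) :* b)) refl (num x) (den x)))
            , (λ x → cross≃ {x ⊗ 1F} {x} (solve 2 (λ a b → a :* con (+ 1) :* b := a :* (b :* con (+ 1))) refl (num x) (den x)))
          ; distrib =
              (λ x y z → cross≃ {x ⊗ (y ⊕ z)} {x ⊗ y ⊕ x ⊗ z} (solve 6 (λ a b c d e f →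
                (a :* (c :* f :+ e :* d)) :* (b :* d :* (b :* f)) := (a :* c :* (b :* f) :+ a :* e :* (b :* d)) :* (b :* (d :* f)))
                refl (num x) (den x) (num y) (den y) (num z) (den z)))
            , (λ x y z → cross≃ {(y ⊕ z) ⊗ x} {y ⊗ x ⊕ z ⊗ x} (solve 6 (λ a b c d e f →
                ((c :* f :+ e :* d) :* a) :* (d :* b :* (f :* b)) := (c :* a :* (f :* b) :+ e :* a :* (d :* b)) :* (d :* f :* b))
                refl (num x) (den x) (num y) (den y) (num z) (den z)))
          }
        ; *-comm = λ x y → cross≃ {x ⊗ y} {y ⊗ x} (solve 4 (λ a b c d → a :* c :* (d :* b) := c :* a :* (b :* d))
            refl (num x) (den x) (num y) (den y))
        }
      }

    invert : (x : Fraction) → Coprime (num x) P → Fraction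
    invert x co = mkFraction (den x , num x) co

    invert-inverseʳ : ∀ x co → x ⊗ invert x co ≃ 1F
    invert-inverseʳ x co = cross≃ {x ⊗ invert x co} {1F}
      (solve 2 (λ a b → a :* b :* con (+ 1) := con (+ 1) :* (b :* a)) refl (num x) (den x))

    divide : ∀ s x y co → s ⊗ y ≃ x → s ≃ x ⊗ invert y co
    divide s x y co (vanishing v) = vanishing (vanishes-cong
      (solve 6 (λ a b c d e f → a :* e :* d :- c :* (b :* f) := a :* (d :* e) :- c :* f :* b) refl
        (num s) (den s) (num x) (den x) (num y) (den y)) v)

    invert-cancel : ∀ x y co → (x ⊗ invert y co) ⊗ y ≃ x
    invert-cancel x y co = cross≃ {(x ⊗ invert y co) ⊗ y} {x}
      (solve 4 (λ a b c d → a :* d :* c :* b := a :* (b :* c :* d)) refl (num x) (den x) (num y) (den y))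

    ≃0 : ∀ {x} U → num x ≈ P * U → x ≃ 0F
    ≃0 {x} U eq = vanishing (1# , U , C-1 , trans
      (solve 2 (λ a b → con (+ 1) :* (a :* con (+ 1) :- con (+ 0) :* b) := a) refl (num x) (den x)) eq)

    -- This and the next lemma serve the two clauses of `oneMinusQ`, for exponents of either sign.
    oneMinus-num : ∀ x co co′ → mkFraction (1# + - x , 1#) co ≃ 1F ⊕ ⊖ mkFraction (x , 1#) co′
    oneMinus-num x co co′ = cross≃ {mkFraction (1# + - x , 1#) co} {1F ⊕ ⊖ mkFraction (x , 1#) co′}
      (solve 1 (λ x → (con (+ 1) :- x) :* (con (+ 1) :* con (+ 1)) := (con (+ 1) :* con (+ 1) :+ (:- x) :* con (+ 1)) :* con (+ 1)) refl x)

    oneMinus-den : ∀ x co co′ → mkFraction (x + - 1# , x) co ≃ 1F ⊕ ⊖ mkFraction (1# , x) co′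
    oneMinus-den x co co′ = cross≃ {mkFraction (x + - 1# , x) co} {1F ⊕ ⊖ mkFraction (1# , x) co′}
      (solve 1 (λ x → (x :- con (+ 1)) :* (con (+ 1) :* x) := (con (+ 1) :* x :+ (:- con (+ 1)) :* con (+ 1)) :* x) refl x)

    -- `V` collects the constant and both denominators, all coprime to `P`; this gives the shape
    -- that `_≡ᵣ_[mod_]` asks for.
    ≃⇒∣ : ∀ {x y} → x ≃ y → ∃[ U ] ∃[ V ] (Coprime V P ×
      ((num x * den y + - (num y * den x)) * V ≈ (P * den x * den y) * U))
    ≃⇒∣ {x} {y} (vanishing (e , U , Ce , eq)) = U , e * (den x * den y) ,
      Coprime-* (Coprime-C Ce) (Coprime-* (coprime x) (coprime y)) ,
      trans (solve 4 (λ z e b d → z :* (e :* (b :* d)) := b :* d :* (e :* z)) refl _ e (den x) (den y))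
        (trans (*-congˡ eq) (solve 4 (λ p u b d → b :* d :* (p :* u) := p :* b :* d :* u) refl P U (den x) (den y)))

  -- q-Pochhammer symbols and a Karlsson–Minton sum

  -- `E a` stands for q^a. Only the exponent laws are assumed, so everything here holds in any
  -- commutative ring with an invertible q.
  module Summation  (E : ℤ → Carrier) (E-0 : E (+ 0) ≈ 1#) (E-+ : ∀ a b → E (a ℤ.+ b) ≈ E a * E b) where

    open RingProperties ring using (-0#≈0#)
    open Powers commutativeSemiring using (_^_; ^-congˡ; ^-distrib-*; ^-homo-*; ^-assocʳ)

    Σ< Π< : ℕ → (ℕ → Carrier) → Carrier
    Σ< zero    f = 0#
    Σ< (suc k) f = f 0 + Σ< k (λ i → f (suc i))
    Π< zero    f = 1#
    Π< (suc k) f = f 0 * Π< k (λ i → f (suc i))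

    Σ<-cong : ∀ k {f g} → (∀ i → i ℕ.< k → f i ≈ g i) → Σ< k f ≈ Σ< k g
    Σ<-cong zero    eq = refl
    Σ<-cong (suc k) eq = +-cong (eq 0 (s≤s z≤n)) (Σ<-cong k (λ i i<k → eq (suc i) (s≤s i<k)))

    Σ<-* : ∀ k x f → x * Σ< k f ≈ Σ< k (λ i → x * f i)
    Σ<-* zero    x f = zeroʳ x
    Σ<-* (suc k) x f = trans (distribˡ x _ _) (+-congˡ (Σ<-* k x _))

    Σ<-+ : ∀ k f g → Σ< k (λ i → f i + g i) ≈ Σ< k f + Σ< k g
    Σ<-+ zero    f g = sym (+-identityʳ 0#)
    Σ<-+ (suc k) f g = trans (+-congˡ (Σ<-+ k _ _))
      (solve 4 (λ a b c d → a :+ b :+ (c :+ d) := a :+ c :+ (b :+ d)) refl (f 0) (g 0) _ _)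

    Π<-cong : ∀ k {f g} → (∀ i → f i ≈ g i) → Π< k f ≈ Π< k g
    Π<-cong zero    eq = refl
    Π<-cong (suc k) eq = *-cong (eq 0) (Π<-cong k (λ i → eq (suc i)))

    Π<-* : ∀ k f g → Π< k f * Π< k g ≈ Π< k (λ i → f i * g i)
    Π<-* zero    f g = *-identityʳ 1#
    Π<-* (suc k) f g = trans
      (solve 4 (λ a b c d → a :* b :* (c :* d) := a :* c :* (b :* d)) refl (f 0) _ (g 0) _)
      (*-congˡ (Π<-* k _ _))

    Π<-+ : ∀ k l f → Π< (k ℕ.+ l) f ≈ Π< k f * Π< l (λ i → f (k ℕ.+ i))
    Π<-+ zero    l f = sym (*-identityˡ _)
    Π<-+ (suc k) l f = trans (*-congˡ (Π<-+ k l _)) (sym (*-assoc _ _ _))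

    Π<-snoc : ∀ k f → Π< (suc k) f ≈ Π< k f * f k
    Π<-snoc zero    f = *-comm _ _
    Π<-snoc (suc k) f = trans (*-congˡ (Π<-snoc k _)) (sym (*-assoc _ _ _))

    Π<-zero : ∀ k i f → i ℕ.< k → f i ≈ 0# → Π< k f ≈ 0#
    Π<-zero (suc k) zero    f _         eq = trans (*-congʳ eq) (zeroˡ _)
    Π<-zero (suc k) (suc i) f (s≤s i<k) eq = trans (*-congˡ (Π<-zero k i _ i<k eq)) (zeroʳ _)

    E-≡ : ∀ {a b} → a ≡ b → E a ≈ E b
    E-≡ a≡b = reflexive (≡.cong E a≡b)

    oneMinus : ℤ → Carrier
    oneMinus a = 1# + - E a

    oneMinus-≡ : ∀ {a b} → a ≡ b → oneMinus a ≈ oneMinus b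
    oneMinus-≡ a≡b = reflexive (≡.cong oneMinus a≡b)

    module _ (d : ℕ) where

      poch : ℤ → ℕ → Carrier
      poch a k = Π< k (λ i → oneMinus (a ℤ.+ + (d ℕ.* i)))

      poch-≡ : ∀ {a b} k → a ≡ b → poch a k ≈ poch b k
      poch-≡ k a≡b = reflexive (≡.cong (λ a → poch a k) a≡b)

      private
        split-index : ∀ a k i → a ℤ.+ + (d ℕ.* (k ℕ.+ i)) ≡ a ℤ.+ + (d ℕ.* k) ℤ.+ + (d ℕ.* i)
        split-index a k i rewrite ℕₚ.*-distribˡ-+ d k i = ≡.sym (ℤₚ.+-assoc a (+ (d ℕ.* k)) (+ (d ℕ.* i)))

        d*0 : ∀ a → a ℤ.+ + (d ℕ.* 0) ≡ a
        d*0 a rewrite ℕₚ.*-zeroʳ d = ℤₚ.+-identityʳ a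

        d*suc : ∀ k → + (d ℕ.* suc k) ≡ + d ℤ.+ + (d ℕ.* k)
        d*suc k = ≡.cong +_ (ℕₚ.*-suc d k)

        shift-index : ∀ a i → a ℤ.+ + (d ℕ.* suc i) ≡ a ℤ.+ + d ℤ.+ + (d ℕ.* i)
        shift-index a i rewrite d*suc i = ≡.sym (ℤₚ.+-assoc a (+ d) (+ (d ℕ.* i)))

      poch-+ : ∀ a k l → poch a (k ℕ.+ l) ≈ poch a k * poch (a ℤ.+ + (d ℕ.* k)) l
      poch-+ a k l = trans (Π<-+ k l _) (*-congˡ (Π<-cong l (λ i → oneMinus-≡ (split-index a k i))))

      poch-snoc : ∀ a k → poch a (suc k) ≈ poch a k * oneMinus (a ℤ.+ + (d ℕ.* k))
      poch-snoc a k = Π<-snoc k _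

      poch-cons : ∀ a k → poch a (suc k) ≈ oneMinus a * poch (a ℤ.+ + d) k
      poch-cons a k = *-cong (oneMinus-≡ (d*0 a)) (Π<-cong k (λ i → oneMinus-≡ (shift-index a i)))

      -- Both sides are (x; p)_{k+l} with x = q^a. Read as (x p^l; p)_k / (x; p)_k = (x p^k; p)_l /
      -- (x; p)_l, it turns a quotient of products of length k into a polynomial in p^k of fixed
      -- degree l.
      poch-exchange : ∀ a k l → poch a k * poch (a ℤ.+ + (d ℕ.* k)) l ≈ poch a l * poch (a ℤ.+ + (d ℕ.* l)) k
      poch-exchange a k l = trans (sym (poch-+ a k l))
        (trans (reflexive (≡.cong (poch a) (ℕₚ.+-comm k l))) (poch-+ a l k))

      -- With p = q^d, the coefficients of ∏_{i<N} (1 - p^{-i} t) as a polynomial in t.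
      binom : ℕ → ℕ → Carrier
      binom zero    zero    = 1#
      binom zero    (suc k) = 0#
      binom (suc N) zero    = 1#
      binom (suc N) (suc k) = binom N (suc k) + - (E (ℤ.- + (d ℕ.* N)) * binom N k)

      binom-0 : ∀ N → binom N 0 ≈ 1#
      binom-0 zero    = refl
      binom-0 (suc N) = refl

      private
        E-*0 : ∀ s → E (s ℤ.* + 0) ≈ 1#
        E-*0 s = trans (E-≡ (ℤₚ.*-zeroʳ s)) E-0

        E-*suc : ∀ s k → E (s ℤ.* + suc k) ≈ E s * E (s ℤ.* + k)
        E-*suc s k = trans (E-≡ (ℤₚ.*-suc s (+ k))) (E-+ _ _)

        E-d*0 : E (+ (d ℕ.* 0)) ≈ 1#
        E-d*0 = trans (E-≡ (≡.cong +_ (ℕₚ.*-zeroʳ d))) E-0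

      -- The generating polynomial at t = q^s. The bound `K` is free because the induction splits
      -- off the term k = 0 and so meets sums of lengths K + 1 and K for the same `N`.
      q-binomial : ∀ N K s → N ℕ.< K →
        Σ< K (λ k → binom N k * E (s ℤ.* + k)) ≈ Π< N (λ i → oneMinus (s ℤ.+ ℤ.- + (d ℕ.* i)))
      q-binomial zero (suc K) s _ = begin
        1# * E (s ℤ.* + 0) + Σ< K (λ k → 0# * E (s ℤ.* + suc k))
          ≈⟨ +-cong (trans (*-identityˡ _) (E-*0 s)) (sym (Σ<-* K 0# _)) ⟩
        1# + 0# * Σ< K (λ k → E (s ℤ.* + suc k))
          ≈⟨ trans (+-congˡ (zeroˡ _)) (+-identityʳ _) ⟩
        1# ∎
      q-binomial (suc N) (suc K) s (s≤s N<K) = begin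
        1# * e 0 + Σ< K (λ k → (binom N (suc k) + - (u * binom N k)) * e (suc k))
          ≈⟨ +-cong (*-congʳ (sym (binom-0 N))) (Σ<-cong K (λ k _ → trans (distribʳ _ _ _) (+-congˡ (step k)))) ⟩
        binom N 0 * e 0 + Σ< K (λ k → binom N (suc k) * e (suc k) + - (u * E s) * (binom N k * e k))
          ≈⟨ +-congˡ (trans (Σ<-+ K _ _) (+-congˡ (sym (Σ<-* K _ _)))) ⟩
        binom N 0 * e 0 + (Σ< K (λ k → binom N (suc k) * e (suc k)) + - (u * E s) * Σ< K (λ k → binom N k * e k))
          ≈⟨ +-assoc _ _ _ ⟨
        Σ< (suc K) (λ k → binom N k * e k) + - (u * E s) * Σ< K (λ k → binom N k * e k)
          ≈⟨ +-cong (q-binomial N (suc K) s (ℕₚ.m<n⇒m<1+n N<K)) (*-congˡ (q-binomial N K s N<K)) ⟩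
        π + - (u * E s) * π
          ≈⟨ solve 3 (λ π u e → π :+ (:- (u :* e)) :* π := π :* (con (+ 1) :- e :* u)) refl π u (E s) ⟩
        π * (1# + - (E s * u))
          ≈⟨ *-congˡ (+-congˡ (-‿cong (E-+ s _))) ⟨
        π * oneMinus (s ℤ.+ ℤ.- + (d ℕ.* N))
          ≈⟨ Π<-snoc N _ ⟨
        Π< (suc N) (λ i → oneMinus (s ℤ.+ ℤ.- + (d ℕ.* i))) ∎
        where
        e = λ k → E (s ℤ.* + k)
        u = E (ℤ.- + (d ℕ.* N))
        π = Π< N (λ i → oneMinus (s ℤ.+ ℤ.- + (d ℕ.* i)))
        step : ∀ k → - (u * binom N k) * e (suc k) ≈ - (u * E s) * (binom N k * e k)
        step k = trans (*-congˡ (E-*suc s k))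
          (solve 4 (λ u b s e → (:- (u :* b)) :* (s :* e) := (:- (u :* s)) :* (b :* e)) refl u (binom N k) (E s) (e k))

      -- The right-hand side divided by (p; p)_k obeys the same Pascal rule. The factor p^k on the
      -- right is the q^{dk} of the summand, so the sum already carries the correct weight.
      binom-closed : ∀ N k → binom N k * poch (+ d) k ≈ poch (ℤ.- + (d ℕ.* N)) k * E (+ (d ℕ.* k))
      binom-closed N zero = trans (*-congʳ (binom-0 N)) (*-congˡ (sym E-d*0))
      -- Here the Pochhammer symbol is (1; p)_{k+1}, whose first factor is zero.
      binom-closed zero (suc k) = begin
        0# * poch (+ d) (suc k)                        ≈⟨ zeroˡ _ ⟩
        0#                                             ≈⟨ zeroˡ _ ⟨
        0# * E (+ (d ℕ.* suc k))                       ≈⟨ *-congʳ (Π<-zero (suc k) 0 (λ i → oneMinus (ℤ.- + (d ℕ.* 0) ℤ.+ + (d ℕ.* i))) (s≤s z≤n) first) ⟨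
        poch (ℤ.- + (d ℕ.* 0)) (suc k) * E (+ (d ℕ.* suc k)) ∎
        where
        first : oneMinus (ℤ.- + (d ℕ.* 0) ℤ.+ + (d ℕ.* 0)) ≈ 0#
        first = trans (+-congˡ (-‿cong (trans (E-≡ (ℤₚ.+-inverseˡ (+ (d ℕ.* 0)))) E-0))) (-‿inverseʳ 1#)
      binom-closed (suc N) (suc k) = begin
        (b′ + - (u * b)) * poch (+ d) (suc k)
          ≈⟨ distribʳ _ _ _ ⟩
        b′ * poch (+ d) (suc k) + - (u * b) * poch (+ d) (suc k)
          ≈⟨ +-cong (binom-closed N (suc k)) (*-congˡ (poch-snoc (+ d) k)) ⟩
        poch (ℤ.- + (d ℕ.* N)) (suc k) * E (+ (d ℕ.* suc k)) + - (u * b) * (Q * oneMinus (+ d ℤ.+ + (d ℕ.* k)))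
          ≈⟨ +-cong (*-cong (trans (poch-snoc (ℤ.- + (d ℕ.* N)) k) (*-congˡ (+-congˡ (-‿cong (E-+ _ _))))) Ek)
                    (*-congˡ (*-congˡ (+-congˡ (-‿cong (E-+ _ _))))) ⟩
        P * (1# + - (u * e)) * (E (+ d) * e) + - (u * b) * (Q * (1# + - (E (+ d) * e)))
          ≈⟨ solve 6 (λ p u e f b q → p :* (con (+ 1) :- u :* e) :* (f :* e) :+ (:- (u :* b)) :* (q :* (con (+ 1) :- f :* e))
               := p :* (con (+ 1) :- u :* e) :* (f :* e) :+ (:- u) :* (con (+ 1) :- f :* e) :* (b :* q))
               refl P u e (E (+ d)) b Q ⟩
        P * (1# + - (u * e)) * (E (+ d) * e) + - u * (1# + - (E (+ d) * e)) * (b * Q)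
          ≈⟨ +-congˡ (*-congˡ (binom-closed N k)) ⟩
        P * (1# + - (u * e)) * (E (+ d) * e) + - u * (1# + - (E (+ d) * e)) * (P * e)
          ≈⟨ solve 4 (λ p u e f → p :* (con (+ 1) :- u :* e) :* (f :* e) :+ (:- u) :* (con (+ 1) :- f :* e) :* (p :* e)
               := (f :- u) :* p :* e) refl P u e (E (+ d)) ⟩
        (E (+ d) + - u) * P * e
          ≈⟨ *-congʳ (*-congʳ (+-congˡ (-‿cong Eu))) ⟩
        (E (+ d) + - (u′ * E (+ d))) * P * e
          ≈⟨ solve 4 (λ f u p e → (f :- u :* f) :* p :* e := (con (+ 1) :- u) :* p :* (f :* e)) refl (E (+ d)) u′ P e ⟩
        oneMinus (ℤ.- + (d ℕ.* suc N)) * P * (E (+ d) * e)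
          ≈⟨ *-cong (*-congˡ (poch-≡ k index)) (sym Ek) ⟩
        oneMinus (ℤ.- + (d ℕ.* suc N)) * poch (ℤ.- + (d ℕ.* suc N) ℤ.+ + d) k * E (+ (d ℕ.* suc k))
          ≈⟨ *-congʳ (poch-cons (ℤ.- + (d ℕ.* suc N)) k) ⟨
        poch (ℤ.- + (d ℕ.* suc N)) (suc k) * E (+ (d ℕ.* suc k)) ∎
        where
        b′ = binom N (suc k)
        b  = binom N k
        u  = E (ℤ.- + (d ℕ.* N))
        u′ = E (ℤ.- + (d ℕ.* suc N))
        e  = E (+ (d ℕ.* k))
        P  = poch (ℤ.- + (d ℕ.* N)) k
        Q  = poch (+ d) k
        Ek : E (+ (d ℕ.* suc k)) ≈ E (+ d) * e
        Ek = trans (E-≡ (d*suc k)) (E-+ _ _)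
        cancelling : ∀ x y → ℤ.- y ≡ ℤ.- (x ℤ.+ y) ℤ.+ x
        cancelling = solve-∀
        index : ℤ.- + (d ℕ.* N) ≡ ℤ.- + (d ℕ.* suc N) ℤ.+ + d
        index rewrite d*suc N = cancelling (+ d) (+ (d ℕ.* N))
        Eu : u ≈ u′ * E (+ d)
        Eu = trans (E-≡ index) (E-+ _ _)

      private
        reversed-poch : ∀ N → Π< N (λ i → oneMinus (+ (d ℕ.* N) ℤ.+ ℤ.- + (d ℕ.* i))) ≈ poch (+ d) N
        reversed-poch zero    = refl
        reversed-poch (suc N) = begin
          oneMinus (+ (d ℕ.* suc N) ℤ.+ ℤ.- + (d ℕ.* 0)) * Π< N (λ i → oneMinus (+ (d ℕ.* suc N) ℤ.+ ℤ.- + (d ℕ.* suc i)))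
            ≈⟨ *-cong (oneMinus-≡ first) (trans (Π<-cong N (λ i → oneMinus-≡ (later i))) (reversed-poch N)) ⟩
          oneMinus (+ d ℤ.+ + (d ℕ.* N)) * poch (+ d) N
            ≈⟨ *-comm _ _ ⟩
          poch (+ d) N * oneMinus (+ d ℤ.+ + (d ℕ.* N))
            ≈⟨ poch-snoc (+ d) N ⟨
          poch (+ d) (suc N) ∎
          where
          first : + (d ℕ.* suc N) ℤ.+ ℤ.- + (d ℕ.* 0) ≡ + d ℤ.+ + (d ℕ.* N)
          first rewrite ℕₚ.*-zeroʳ d = ≡.trans (ℤₚ.+-identityʳ _) (d*suc N)
          cancelling : ∀ x y z → x ℤ.+ y ℤ.+ ℤ.- (x ℤ.+ z) ≡ y ℤ.+ ℤ.- z
          cancelling = solve-∀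
          later : ∀ i → + (d ℕ.* suc N) ℤ.+ ℤ.- + (d ℕ.* suc i) ≡ + (d ℕ.* N) ℤ.+ ℤ.- + (d ℕ.* i)
          later i rewrite d*suc N | d*suc i = cancelling (+ d) (+ (d ℕ.* N)) (+ (d ℕ.* i))

      -- As a polynomial in p^k, (q^b p^k; p)_m has leading coefficient (-1)^m q^σ with σ this sum.
      progressionSum : ℤ → ℕ → ℤ
      progressionSum b zero    = + 0
      progressionSum b (suc m) = b ℤ.+ progressionSum (b ℤ.+ + d) m

      module Extraction (N K : ℕ) (N<K : N ℕ.< K) where

        weighted : (ℕ → Carrier) → Carrier
        weighted f = Σ< K (λ k → binom N k * f k)

        moment : (ℕ → Carrier) → ℕ → Carrier
        moment f s = weighted (λ k → E (+ (d ℕ.* s) ℤ.* + k) * f k)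

        weighted-cong : ∀ {f g} → (∀ k → f k ≈ g k) → weighted f ≈ weighted g
        weighted-cong eq = Σ<-cong K (λ k _ → *-congˡ (eq k))

        -- For f(k) a polynomial in p^k of degree M with leading coefficient (-1)^M q^σ, only the top
        -- degree N survives under `weighted`.
        LeadingTerm : (ℕ → Carrier) → ℕ → ℤ → Set ℓ
        LeadingTerm f M σ = ∀ s →
          (s ℕ.+ M ℕ.< N → moment f s ≈ 0#) × (s ℕ.+ M ≡ N → moment f s ≈ (- 1#) ^ M * E σ * poch (+ d) N)

        leading-cong : ∀ {f g M M′ σ σ′} → (∀ k → f k ≈ g k) → M ≡ M′ → σ ≡ σ′ → LeadingTerm f M σ → LeadingTerm g M′ σ′
        leading-cong eq ≡.refl ≡.refl L s =
          (λ lt → trans (weighted-cong (λ k → *-congˡ (sym (eq k)))) (proj₁ (L s) lt)) ,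
          (λ eqN → trans (weighted-cong (λ k → *-congˡ (sym (eq k)))) (proj₂ (L s) eqN))

        -- By `q-binomial` the moment is the product of 1 - p^{s-i} over i < N. Its factor i = s is
        -- zero when s < N, and for s = N it is (p; p)_N in reverse order.
        leading-1 : LeadingTerm (λ _ → 1#) 0 (+ 0)
        leading-1 s = below , top
          where
          product : moment (λ _ → 1#) s ≈ Π< N (λ i → oneMinus (+ (d ℕ.* s) ℤ.+ ℤ.- + (d ℕ.* i)))
          product = trans (weighted-cong (λ k → *-identityʳ _)) (q-binomial N K (+ (d ℕ.* s)) N<K)
          below : s ℕ.+ 0 ℕ.< N → moment (λ _ → 1#) s ≈ 0#
          below lt = trans product (Π<-zero N s _ (≡.subst (ℕ._< N) (ℕₚ.+-identityʳ s) lt)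
            (trans (+-congˡ (-‿cong (trans (E-≡ (ℤₚ.+-inverseʳ (+ (d ℕ.* s)))) E-0))) (-‿inverseʳ 1#)))
          top : s ℕ.+ 0 ≡ N → moment (λ _ → 1#) s ≈ 1# * E (+ 0) * poch (+ d) N
          top eq with ≡.trans (≡.sym (ℕₚ.+-identityʳ s)) eq
          ... | ≡.refl = trans product (trans (reversed-poch s)
                  (trans (sym (*-identityˡ _)) (*-congʳ (trans (sym E-0) (sym (*-identityˡ _))))))

        -- A factor 1 - q^b p^k replaces the moment at s by itself minus q^b times the moment at s +
        -- 1. Below the top both are zero; at the top only the second survives. This passage from s
        -- to s + 1 is why `LeadingTerm` speaks of all s.
        leading-linear : ∀ {f M σ} b → LeadingTerm f M σ →
          LeadingTerm (λ k → oneMinus (b ℤ.+ + (d ℕ.* k)) * f k) (suc M) (b ℤ.+ σ)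
        leading-linear {f} {M} {σ} b L s = below , top
          where
          index : ∀ k → + (d ℕ.* s) ℤ.* + k ℤ.+ + (d ℕ.* k) ≡ + (d ℕ.* suc s) ℤ.* + k
          index k = ≡.trans (≡.cong (λ x → + (d ℕ.* s) ℤ.* + k ℤ.+ x) (ℤₚ.pos-* d k))
            (≡.trans (≡.sym (ℤₚ.*-distribʳ-+ (+ k) (+ (d ℕ.* s)) (+ d)))
              (≡.cong (ℤ._* + k) (≡.trans (ℤₚ.+-comm (+ (d ℕ.* s)) (+ d)) (≡.sym (d*suc s)))))
          split : moment (λ k → oneMinus (b ℤ.+ + (d ℕ.* k)) * f k) s ≈ moment f s + - E b * moment f (suc s)
          split = begin
            moment (λ k → oneMinus (b ℤ.+ + (d ℕ.* k)) * f k) s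
              ≈⟨ Σ<-cong K (λ k _ → trans
                   (*-congˡ (*-congˡ (*-congʳ (+-congˡ (-‿cong (E-+ b _))))))
                   (solve 5 (λ c e β g f → c :* (e :* ((con (+ 1) :- β :* g) :* f)) := c :* (e :* f) :+ (:- β) :* (c :* ((e :* g) :* f)))
                      refl (binom N k) _ (E b) _ (f k))) ⟩
            Σ< K (λ k → binom N k * (E (+ (d ℕ.* s) ℤ.* + k) * f k)
                      + - E b * (binom N k * (E (+ (d ℕ.* s) ℤ.* + k) * E (+ (d ℕ.* k)) * f k)))
              ≈⟨ trans (Σ<-+ K _ _) (+-congˡ (sym (Σ<-* K _ _))) ⟩
            moment f s + - E b * weighted (λ k → E (+ (d ℕ.* s) ℤ.* + k) * E (+ (d ℕ.* k)) * f k)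
              ≈⟨ +-congˡ (*-congˡ (weighted-cong (λ k → *-congʳ (trans (sym (E-+ _ _)) (E-≡ (index k)))))) ⟩
            moment f s + - E b * moment f (suc s) ∎
          below : s ℕ.+ suc M ℕ.< N → _
          below lt with ≡.subst (ℕ._< N) (ℕₚ.+-suc s M) lt
          ... | lt′ = trans split (trans
            (+-cong (proj₁ (L s) (ℕₚ.<-trans (ℕₚ.n<1+n _) lt′)) (*-congˡ (proj₁ (L (suc s)) lt′)))
            (solve 1 (λ b → con (+ 0) :+ (:- b) :* con (+ 0) := con (+ 0)) refl (E b)))
          top : s ℕ.+ suc M ≡ N → _
          top eq with ≡.trans (≡.sym (ℕₚ.+-suc s M)) eq
          ... | eq′ = trans split (trans
            (+-cong (proj₁ (L s) (≡.subst (s ℕ.+ M ℕ.<_) eq′ (ℕₚ.n<1+n _))) (*-congˡ (proj₂ (L (suc s)) eq′)))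
            (trans (solve 4 (λ b g e p → con (+ 0) :+ (:- b) :* (g :* e :* p) := (:- con (+ 1)) :* g :* (b :* e) :* p)
                     refl (E b) _ (E σ) _)
                   (*-congʳ (*-congˡ (sym (E-+ b σ))))))

        leading-poch : ∀ {f M σ} b m → LeadingTerm f M σ →
          LeadingTerm (λ k → poch (b ℤ.+ + (d ℕ.* k)) m * f k) (m ℕ.+ M) (progressionSum b m ℤ.+ σ)
        leading-poch {σ = σ} b zero L =
          leading-cong (λ k → sym (*-identityˡ _)) ≡.refl (≡.sym (ℤₚ.+-identityˡ σ)) L
        leading-poch {f} {σ = σ} b (suc m) L =
          leading-cong peel ≡.refl (≡.sym (ℤₚ.+-assoc b _ σ)) (leading-linear b (leading-poch (b ℤ.+ + d) m L))
          where
          rearrange : ∀ x y z → x ℤ.+ y ℤ.+ z ≡ x ℤ.+ z ℤ.+ y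
          rearrange = solve-∀
          peel : ∀ k → oneMinus (b ℤ.+ + (d ℕ.* k)) * (poch (b ℤ.+ + d ℤ.+ + (d ℕ.* k)) m * f k)
                     ≈ poch (b ℤ.+ + (d ℕ.* k)) (suc m) * f k
          peel k = trans (sym (*-assoc _ _ _)) (*-congʳ (trans
            (*-congˡ (poch-≡ m (rearrange b (+ d) (+ (d ℕ.* k))))) (sym (poch-cons _ m))))

        leading-poch^ : ∀ {f M σ} b m j → LeadingTerm f M σ →
          LeadingTerm (λ k → poch (b ℤ.+ + (d ℕ.* k)) m ^ j * f k) (j ℕ.* m ℕ.+ M) (+ j ℤ.* progressionSum b m ℤ.+ σ)
        leading-poch^ {σ = σ} b m zero L =
          leading-cong (λ k → sym (*-identityˡ _)) ≡.refl
            (≡.trans (≡.sym (ℤₚ.+-identityˡ σ)) (≡.cong (ℤ._+ σ) (≡.sym (ℤₚ.*-zeroˡ (progressionSum b m))))) L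
        leading-poch^ {M = M} {σ = σ} b m (suc j) L =
          leading-cong (λ k → sym (*-assoc _ _ _)) (≡.sym (ℕₚ.+-assoc m (j ℕ.* m) M))
            (distribution (progressionSum b m) (+ j) σ) (leading-poch b m (leading-poch^ b m j L))
          where
          distribution : ∀ x j σ → x ℤ.+ (j ℤ.* x ℤ.+ σ) ≡ (+ 1 ℤ.+ j) ℤ.* x ℤ.+ σ
          distribution = solve-∀

        leading-coefficient : ∀ {f σ} → LeadingTerm f N σ → weighted f ≈ (- 1#) ^ N * E σ * poch (+ d) N
        leading-coefficient L = trans
          (weighted-cong (λ k → trans (sym (*-identityˡ _)) (*-congʳ (sym (trans (E-≡ (index k)) E-0)))))
          (proj₂ (L 0) ≡.refl)
          where
          index : ∀ k → + (d ℕ.* 0) ℤ.* + k ≡ + 0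
          index k rewrite ℕₚ.*-zeroʳ d = ℤₚ.*-zeroˡ (+ k)

      module FirstOrder (n : ℕ) (ε²≈0 : oneMinus (+ n) * oneMinus (+ n) ≈ 0#) where

        private
          ε = oneMinus (+ n)

        -- The two sides differ by ε (1 - q^n) q^a = ε² q^a.
        ε-shift : ∀ a → ε * E a ≈ ε * E (a ℤ.+ + n)
        ε-shift a = begin
          ε * E a                                   ≈⟨ +-identityʳ _ ⟨
          ε * E a + 0#                              ≈⟨ +-congˡ (trans (*-congʳ (trans (-‿cong ε²≈0) -0#≈0#)) (zeroˡ _)) ⟨
          ε * E a + - (ε * ε) * E a                 ≈⟨ solve 2 (λ x a → (con (+ 1) :- x) :* a :+ (:- ((con (+ 1) :- x) :* (con (+ 1) :- x))) :* a
                                                         := (con (+ 1) :- x) :* (a :* x)) refl (E (+ n)) (E a) ⟩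
          ε * (E a * E (+ n))                       ≈⟨ *-congˡ (E-+ a (+ n)) ⟨
          ε * E (a ℤ.+ + n)                         ∎

        ε-shifts : ∀ a c → ε * E (a ℤ.+ ℤ.- + (c ℕ.* n)) ≈ ε * E a
        ε-shifts a zero    = *-congˡ (E-≡ (ℤₚ.+-identityʳ a))
        ε-shifts a (suc c) = trans (ε-shift _) (trans (*-congˡ (E-≡ (index a (+ n) (+ (c ℕ.* n))))) (ε-shifts a c))
          where
          index : ∀ a x y → a ℤ.+ ℤ.- (x ℤ.+ y) ℤ.+ x ≡ a ℤ.+ ℤ.- y
          index = solve-∀

        -- (1 - x)(1 - y q^n) and (1 - x q^n)(1 - y) differ by (1 - q^n)(x - y).
        poch-transfer : ∀ a b k → ε * E a ≈ ε * E b →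
          poch a k * poch (b ℤ.+ + n) k ≈ poch (a ℤ.+ + n) k * poch b k
        poch-transfer a b k a~b = trans (Π<-* k _ _) (trans (Π<-cong k factor) (sym (Π<-* k _ _)))
          where
          swap : ∀ a n x → a ℤ.+ n ℤ.+ x ≡ a ℤ.+ x ℤ.+ n
          swap = solve-∀
          factor : ∀ i → oneMinus (a ℤ.+ + (d ℕ.* i)) * oneMinus (b ℤ.+ + n ℤ.+ + (d ℕ.* i))
                       ≈ oneMinus (a ℤ.+ + n ℤ.+ + (d ℕ.* i)) * oneMinus (b ℤ.+ + (d ℕ.* i))
          factor i = begin
            oneMinus (a ℤ.+ x) * oneMinus (b ℤ.+ + n ℤ.+ x)
              ≈⟨ *-congˡ (+-congˡ (-‿cong (trans (E-≡ (swap b (+ n) x)) (E-+ _ _)))) ⟩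
            (1# + - E (a ℤ.+ x)) * (1# + - (E (b ℤ.+ x) * E (+ n)))
              ≈⟨ solve 3 (λ a b e → (con (+ 1) :- a) :* (con (+ 1) :- b :* e)
                   := (con (+ 1) :- a :* e) :* (con (+ 1) :- b) :+ ((con (+ 1) :- e) :* b :- (con (+ 1) :- e) :* a))
                   refl (E (a ℤ.+ x)) (E (b ℤ.+ x)) (E (+ n)) ⟩
            (1# + - (E (a ℤ.+ x) * E (+ n))) * oneMinus (b ℤ.+ x) + (ε * E (b ℤ.+ x) + - (ε * E (a ℤ.+ x)))
              ≈⟨ +-congˡ (trans (+-congˡ (-‿cong shifted)) (-‿inverseʳ _)) ⟩
            (1# + - (E (a ℤ.+ x) * E (+ n))) * oneMinus (b ℤ.+ x) + 0#
              ≈⟨ +-identityʳ _ ⟩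
            (1# + - (E (a ℤ.+ x) * E (+ n))) * oneMinus (b ℤ.+ x)
              ≈⟨ *-congʳ (+-congˡ (-‿cong (trans (sym (E-+ _ _)) (E-≡ (≡.sym (swap a (+ n) x)))))) ⟩
            oneMinus (a ℤ.+ + n ℤ.+ x) * oneMinus (b ℤ.+ x) ∎
            where
            x = + (d ℕ.* i)
            shifted : ε * E (a ℤ.+ x) ≈ ε * E (b ℤ.+ x)
            shifted = trans (*-congˡ (E-+ a x)) (trans (sym (*-assoc _ _ _)) (trans (*-congʳ a~b)
              (trans (*-assoc _ _ _) (*-congˡ (sym (E-+ b x))))))

        private
          minus-suc : ∀ a c → a ℤ.+ ℤ.- + (suc c ℕ.* n) ℤ.+ + n ≡ a ℤ.+ ℤ.- + (c ℕ.* n)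
          minus-suc a c = index a (+ n) (+ (c ℕ.* n))
            where
            index : ∀ a x y → a ℤ.+ ℤ.- (x ℤ.+ y) ℤ.+ x ≡ a ℤ.+ ℤ.- y
            index = solve-∀

        -- In units of n, the shifts -(c+1) and 1 become -c and 0: one unit is moved from one symbol
        -- to the other.
        poch-step : ∀ a c k →
          poch (a ℤ.+ ℤ.- + (suc c ℕ.* n)) k * poch (a ℤ.+ + n) k ≈ poch (a ℤ.+ ℤ.- + (c ℕ.* n)) k * poch a k
        poch-step a c k = trans (poch-transfer _ a k (ε-shifts a (suc c))) (*-congʳ (poch-≡ k (minus-suc a c)))

        poch-symmetric : ∀ a k → poch (a ℤ.+ ℤ.- + n) k * poch (a ℤ.+ + n) k ≈ poch a k * poch a k
        poch-symmetric a k = trans (*-congʳ (poch-≡ k (≡.cong (λ x → a ℤ.+ ℤ.- + x) (≡.sym (ℕₚ.*-identityˡ n)))))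
          (trans (poch-step a 0 k) (*-congʳ (poch-≡ k (ℤₚ.+-identityʳ a))))

        -- The shifts -(j+2), 2 and j times 1 sum to zero. `poch-step` cancels one of the ones
        -- against the negative shift, which gives the induction on `j`.
        poch-spread : ∀ a j k →
          poch (a ℤ.+ ℤ.- + (suc (suc j) ℕ.* n)) k * poch (a ℤ.+ + n ℤ.+ + n) k * poch (a ℤ.+ + n) k ^ j
          ≈ poch a k ^ suc (suc j)
        poch-spread a zero k = begin
          poch (a ℤ.+ ℤ.- + (2 ℕ.* n)) k * poch (a ℤ.+ + n ℤ.+ + n) k * 1#
            ≈⟨ *-identityʳ _ ⟩
          poch (a ℤ.+ ℤ.- + (2 ℕ.* n)) k * poch (a ℤ.+ + n ℤ.+ + n) k
            ≈⟨ poch-transfer _ (a ℤ.+ + n) k (trans (ε-shifts a 2) (ε-shift a)) ⟩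
          poch (a ℤ.+ ℤ.- + (2 ℕ.* n) ℤ.+ + n) k * poch (a ℤ.+ + n) k
            ≈⟨ *-congʳ (poch-≡ k (minus-suc a 1)) ⟩
          poch (a ℤ.+ ℤ.- + (1 ℕ.* n)) k * poch (a ℤ.+ + n) k
            ≈⟨ trans (poch-step a 0 k) (*-congʳ (poch-≡ k (ℤₚ.+-identityʳ a))) ⟩
          poch a k * poch a k
            ≈⟨ *-congˡ (*-identityʳ _) ⟨
          poch a k ^ 2 ∎
        poch-spread a (suc j) k = begin
          x * y * (z * z ^ j)                            ≈⟨ solve 4 (λ x y z w → x :* y :* (z :* w) := x :* z :* y :* w) refl x y z (z ^ j) ⟩
          x * z * y * z ^ j                              ≈⟨ *-congʳ (*-congʳ (poch-step a (suc (suc j)) k)) ⟩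
          poch (a ℤ.+ ℤ.- + (suc (suc j) ℕ.* n)) k * poch a k * y * z ^ j
                                                         ≈⟨ solve 4 (λ x y z w → x :* z :* y :* w := z :* (x :* y :* w)) refl _ y (poch a k) (z ^ j) ⟩
          poch a k * (poch (a ℤ.+ ℤ.- + (suc (suc j) ℕ.* n)) k * y * z ^ j)
                                                         ≈⟨ *-congˡ (poch-spread a j k) ⟩
          poch a k ^ suc (suc (suc j)) ∎
          where
          x = poch (a ℤ.+ ℤ.- + (suc (suc (suc j)) ℕ.* n)) k
          y = poch (a ℤ.+ + n ℤ.+ + n) k
          z = poch (a ℤ.+ + n) k

    -- The parameters are j = d - 3, the number of symbols with shift 1, and μ = m - 2, the degree
    -- contributed by q^{1-d}; the condition n ≥ 2d - 1 is what gives m ≥ 2. `unit` inverts 1 -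
    -- p^{i+1}.
    module Evaluation (j μ n : ℕ) (n+1≡dm : suc n ≡ (3 ℕ.+ j) ℕ.* (2 ℕ.+ μ))
      (ε²≈0 : oneMinus (+ n) * oneMinus (+ n) ≈ 0#)
      (unit : ∀ i → suc i ℕ.< n → ∃[ y ] oneMinus (+ (3 ℕ.+ j) ℤ.+ + ((3 ℕ.+ j) ℕ.* i)) * y ≈ 1#) where

      private
        d = 3 ℕ.+ j
        m = 2 ℕ.+ μ

      -- Written as the degree that the `leading-poch` lemmas compute for `kernel`, down to the
      -- final 0 from `leading-1`.
      N : ℕ
      N = j ℕ.* m ℕ.+ (m ℕ.+ (μ ℕ.+ 0))

      -- The paper's n - 1 - m.
      n≡1+N+m : n ≡ suc (N ℕ.+ m)
      n≡1+N+m = ℕₚ.suc-injective (≡.trans n+1≡dm (identity j μ))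
        where
        identity : ∀ j μ → (3 ℕ.+ j) ℕ.* (2 ℕ.+ μ) ≡ suc (suc (j ℕ.* (2 ℕ.+ μ) ℕ.+ (2 ℕ.+ μ ℕ.+ (μ ℕ.+ 0)) ℕ.+ (2 ℕ.+ μ)))
        identity = solve-∀ℕ

      private
        pochᵈ = poch d
        open FirstOrder d n ε²≈0

        N<n : N ℕ.< n
        N<n = ≡.subst (N ℕ.<_) (≡.sym n≡1+N+m) (s≤s (ℕₚ.m≤m+n N m))

        open Extraction d N n N<n

        +n : + n ≡ + d ℤ.* + m ℤ.- + 1
        +n = ≡.trans (index (+ n)) (≡.cong (ℤ._- + 1) (≡.trans (≡.cong +_ n+1≡dm) (ℤₚ.pos-* d m)))
          where
          index : ∀ x → x ≡ + 1 ℤ.+ x ℤ.- + 1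
          index = solve-∀

        +N : + N ≡ + j ℤ.* + m ℤ.+ (+ m ℤ.+ + μ)
        +N = ≡.cong₂ ℤ._+_ (ℤₚ.pos-* j m) (≡.cong (λ x → + m ℤ.+ + x) (ℕₚ.+-identityʳ μ))

        b₊ b₋ : ℤ
        b₊ = + d ℤ.+ + n
        b₋ = + d ℤ.+ ℤ.- + n

        -- Since N + 2 = (d-1) m, one has d (N + 2) = (d-1)(n + 1).
        exponent-N : + suc d ℤ.+ ℤ.- + (suc (suc j) ℕ.* n) ≡ ℤ.- + (d ℕ.* N)
        exponent-N = ≡.trans
          (≡.cong (λ x → + suc d ℤ.+ ℤ.- x) (≡.trans (ℤₚ.pos-* (suc (suc j)) n) (≡.cong (λ x → + suc (suc j) ℤ.* x) +n)))
          (≡.trans (identity (+ j) (+ μ))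
            (≡.cong ℤ.-_ (≡.sym (≡.trans (ℤₚ.pos-* d N) (≡.cong (λ x → + d ℤ.* x) +N)))))
          where
          identity : ∀ j μ → + 4 ℤ.+ j ℤ.+ ℤ.- ((+ 2 ℤ.+ j) ℤ.* ((+ 3 ℤ.+ j) ℤ.* (+ 2 ℤ.+ μ) ℤ.- + 1))
            ≡ ℤ.- ((+ 3 ℤ.+ j) ℤ.* (j ℤ.* (+ 2 ℤ.+ μ) ℤ.+ (+ 2 ℤ.+ μ ℤ.+ μ)))
          identity = solve-∀

        exponent₁ : + suc d ℤ.+ + n ≡ + d ℤ.+ + (d ℕ.* m)
        exponent₁ = ≡.trans (identity (+ j) (+ n)) (≡.cong (λ x → + d ℤ.+ + x) n+1≡dm)
          where
          identity : ∀ j n → + 4 ℤ.+ j ℤ.+ n ≡ + 3 ℤ.+ j ℤ.+ (+ 1 ℤ.+ n)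
          identity = solve-∀

        exponent₂ : + suc d ℤ.+ + n ℤ.+ + n ≡ b₊ ℤ.+ + (d ℕ.* m)
        exponent₂ = ≡.trans (≡.cong (ℤ._+ + n) exponent₁) (identity (+ d) (+ (d ℕ.* m)) (+ n))
          where
          identity : ∀ x y z → x ℤ.+ y ℤ.+ z ≡ x ℤ.+ z ℤ.+ y
          identity = solve-∀

        exponent₃ : + 1 ℤ.- + d ≡ b₋ ℤ.+ + (d ℕ.* μ)
        exponent₃ = ≡.trans (identity (+ j) (+ μ))
          (≡.cong₂ (λ x y → + d ℤ.+ ℤ.- x ℤ.+ y) (≡.sym +n) (≡.sym (ℤₚ.pos-* d μ)))
          where
          identity : ∀ j μ → + 1 ℤ.- (+ 3 ℤ.+ j) ≡ + 3 ℤ.+ j ℤ.+ ℤ.- ((+ 3 ℤ.+ j) ℤ.* (+ 2 ℤ.+ μ) ℤ.- + 1) ℤ.+ (+ 3 ℤ.+ j) ℤ.* μ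
          identity = solve-∀

        exponent₄ : b₋ ℤ.+ + (d ℕ.* suc μ) ≡ + 1
        exponent₄ = ≡.trans
          (≡.cong₂ (λ x y → + d ℤ.+ ℤ.- x ℤ.+ y) +n (ℤₚ.pos-* d (suc μ)))
          (identity (+ j) (+ μ))
          where
          identity : ∀ j μ → + 3 ℤ.+ j ℤ.+ ℤ.- ((+ 3 ℤ.+ j) ℤ.* (+ 2 ℤ.+ μ) ℤ.- + 1) ℤ.+ (+ 3 ℤ.+ j) ℤ.* (+ 1 ℤ.+ μ) ≡ + 1
          identity = solve-∀

        invertible-* : ∀ {x y} → ∃[ z ] x * z ≈ 1# → ∃[ z ] y * z ≈ 1# → ∃[ z ] x * y * z ≈ 1#
        invertible-* {x} {y} (x⁻ , eq) (y⁻ , eq′) = x⁻ * y⁻ ,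
          trans (solve 4 (λ x y a b → x :* y :* (a :* b) := x :* a :* (y :* b)) refl x y x⁻ y⁻)
            (trans (*-cong eq eq′) (*-identityʳ 1#))

        invertible-^ : ∀ {x} k → ∃[ z ] x * z ≈ 1# → ∃[ z ] x ^ k * z ≈ 1#
        invertible-^ zero    u = 1# , *-identityʳ 1#
        invertible-^ (suc k) u = invertible-* u (invertible-^ k u)

        invertible-poch : ∀ k → k ℕ.< n → ∃[ z ] pochᵈ (+ d) k * z ≈ 1#
        invertible-poch zero    k<n = 1# , *-identityʳ 1#
        invertible-poch (suc k) k<n with invertible-* (invertible-poch k (ℕₚ.<-trans (ℕₚ.n<1+n k) k<n)) (unit k k<n)
        ... | z , eq = z , trans (*-congʳ (poch-snoc d (+ d) k)) eq

        cancel : ∀ {x y u} → ∃[ z ] u * z ≈ 1# → x * u ≈ y * u → x ≈ y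
        cancel {x} {y} {u} (z , uz≈1) xu≈yu = begin
          x            ≈⟨ *-identityʳ x ⟨
          x * 1#       ≈⟨ *-congˡ uz≈1 ⟨
          x * (u * z)  ≈⟨ *-assoc _ _ _ ⟨
          x * u * z    ≈⟨ *-congʳ xu≈yu ⟩
          y * u * z    ≈⟨ *-assoc _ _ _ ⟩
          y * (u * z)  ≈⟨ *-congˡ uz≈1 ⟩
          y * 1#       ≈⟨ *-identityʳ y ⟩
          y            ∎

        -- The numerators that remain after `poch-exchange`, as a polynomial in p^k: j blocks of
        -- degree m, one of degree m and one of degree μ.
        kernel : ℕ → Carrier
        kernel k = pochᵈ (+ d ℤ.+ + (d ℕ.* k)) m ^ j
                 * (pochᵈ (b₊ ℤ.+ + (d ℕ.* k)) m * (pochᵈ (b₋ ℤ.+ + (d ℕ.* k)) μ * 1#))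

        σ : ℤ
        σ = + j ℤ.* progressionSum d (+ d) m ℤ.+ (progressionSum d b₊ m ℤ.+ (progressionSum d b₋ μ ℤ.+ + 0))

        kernel-leading : LeadingTerm kernel N σ
        kernel-leading = leading-poch^ (+ d) m j (leading-poch b₊ m (leading-poch b₋ μ leading-1))

        -- The denominators free of k that `poch-exchange` leaves behind. Multiplying the sum by
        -- them avoids dividing.
        normalizer : Carrier
        normalizer = pochᵈ (+ d) m ^ j * pochᵈ b₊ m * pochᵈ b₋ μ

        module _ (t : ℕ → Carrier) (t-eq : ∀ k → k ℕ.< n →
          t k * pochᵈ (+ d) k ^ d ≈ pochᵈ (+ suc d) k ^ suc (suc j) * pochᵈ (+ 1 ℤ.- + d) k * E (+ (d ℕ.* k))) where

          -- Compared after multiplication by (p; p)_k^d, which is a unit because k < n.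
          term : ∀ k → k ℕ.< n → t k * normalizer ≈ binom d N k * kernel k
          term k k<n = cancel (invertible-^ d (invertible-poch k k<n)) (begin
            t k * (X₀ ^ j * X₊ * X₋) * B ^ d
              ≈⟨ solve 5 (λ t x y z b → t :* (x :* y :* z) :* b := x :* y :* z :* (t :* b)) refl (t k) (X₀ ^ j) X₊ X₋ (B ^ d) ⟩
            X₀ ^ j * X₊ * X₋ * (t k * B ^ d)
              ≈⟨ *-congˡ (t-eq k k<n) ⟩
            X₀ ^ j * X₊ * X₋ * (pochᵈ (+ suc d) k ^ suc (suc j) * pochᵈ (+ 1 ℤ.- + d) k * e)
              ≈⟨ *-congˡ (*-congʳ (*-cong spread (poch-≡ d k exponent₃))) ⟩
            X₀ ^ j * X₊ * X₋ * (P * Y₊ * Y₀ ^ j * Y₋ * e)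
              ≈⟨ solve 8 (λ x y z p u v w e → x :* y :* z :* (p :* u :* v :* w :* e)
                   := (p :* e) :* (x :* v) :* (y :* u) :* (z :* w)) refl (X₀ ^ j) X₊ X₋ P Y₊ (Y₀ ^ j) Y₋ e ⟩
            (P * e) * (X₀ ^ j * Y₀ ^ j) * (X₊ * Y₊) * (X₋ * Y₋)
              -- The terminating symbol with its p^k becomes a binomial coefficient times (p; p)_k;
              -- each of the other pairs exchanges length k for length m or μ.
              ≈⟨ *-cong (*-cong (*-cong (sym (binom-closed d N k)) power) (poch-exchange d b₊ m k)) (poch-exchange d b₋ μ k) ⟩
            (β * B) * (B ^ j * G₀ ^ j) * (B₊ * G₊) * (B₋ * G₋)
              ≈⟨ solve 8 (λ c b bj g₀ b₊ g₊ b₋ g₋ → (c :* b) :* (bj :* g₀) :* (b₊ :* g₊) :* (b₋ :* g₋)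
                   := c :* (g₀ :* (g₊ :* (g₋ :* con (+ 1)))) :* (b :* bj :* (b₋ :* b₊))) refl β B (B ^ j) (G₀ ^ j) B₊ G₊ B₋ G₋ ⟩
            β * kernel k * (B * B ^ j * (B₋ * B₊))
              ≈⟨ *-congˡ (*-congˡ (poch-symmetric (+ d) k)) ⟩
            β * kernel k * (B * B ^ j * (B * B))
              ≈⟨ *-congˡ (solve 2 (λ b bj → b :* bj :* (b :* b) := b :* (b :* (b :* bj))) refl B (B ^ j)) ⟩
            β * kernel k * B ^ d ∎)
            where
            β = binom d N k
            e = E (+ (d ℕ.* k))
            X₀ = pochᵈ (+ d) m
            X₊ = pochᵈ b₊ m
            X₋ = pochᵈ b₋ μ
            Y₀ = pochᵈ (+ d ℤ.+ + (d ℕ.* m)) k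
            Y₊ = pochᵈ (b₊ ℤ.+ + (d ℕ.* m)) k
            Y₋ = pochᵈ (b₋ ℤ.+ + (d ℕ.* μ)) k
            B = pochᵈ (+ d) k
            B₊ = pochᵈ b₊ k
            B₋ = pochᵈ b₋ k
            G₀ = pochᵈ (+ d ℤ.+ + (d ℕ.* k)) m
            G₊ = pochᵈ (b₊ ℤ.+ + (d ℕ.* k)) m
            G₋ = pochᵈ (b₋ ℤ.+ + (d ℕ.* k)) μ
            P = pochᵈ (ℤ.- + (d ℕ.* N)) k
            spread : pochᵈ (+ suc d) k ^ suc (suc j) ≈ P * Y₊ * Y₀ ^ j
            spread = trans (sym (poch-spread (+ suc d) j k)) (*-cong
              (*-cong (poch-≡ d k exponent-N) (poch-≡ d k exponent₂)) (^-congˡ j (poch-≡ d k exponent₁)))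
            power : X₀ ^ j * Y₀ ^ j ≈ B ^ j * G₀ ^ j
            power = trans (sym (^-distrib-* X₀ Y₀ j))
              (trans (^-congˡ j (poch-exchange d (+ d) m k)) (^-distrib-* B G₀ j))

          normalized-sum : Σ< n t * normalizer ≈ (- 1#) ^ N * E σ * pochᵈ (+ d) N
          normalized-sum = begin
            Σ< n t * normalizer                   ≈⟨ *-comm _ _ ⟩
            normalizer * Σ< n t                   ≈⟨ Σ<-* n normalizer t ⟩
            Σ< n (λ k → normalizer * t k)         ≈⟨ Σ<-cong n (λ k k<n → trans (*-comm _ _) (term k k<n)) ⟩
            weighted kernel                       ≈⟨ leading-coefficient kernel-leading ⟩
            (- 1#) ^ N * E σ * pochᵈ (+ d) N      ∎

        normalizer-* : normalizer * (oneMinus (+ 1 ℤ.- + d) * oneMinus (+ 1)) ≈ pochᵈ (+ d) m ^ suc (suc j)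
        normalizer-* = begin
          X₀ ^ j * X₊ * X₋ * (oneMinus (+ 1 ℤ.- + d) * oneMinus (+ 1))
            ≈⟨ solve 5 (λ x y z u v → x :* y :* z :* (u :* v) := x :* (z :* u :* v :* y)) refl (X₀ ^ j) X₊ X₋ _ _ ⟩
          X₀ ^ j * (X₋ * oneMinus (+ 1 ℤ.- + d) * oneMinus (+ 1) * X₊)
            ≈⟨ *-congˡ (*-congʳ (*-cong (*-congˡ (oneMinus-≡ exponent₃)) (oneMinus-≡ (≡.sym exponent₄)))) ⟩
          X₀ ^ j * (X₋ * oneMinus (b₋ ℤ.+ + (d ℕ.* μ)) * oneMinus (b₋ ℤ.+ + (d ℕ.* suc μ)) * X₊)
            ≈⟨ *-congˡ (*-congʳ (trans (poch-snoc d b₋ (suc μ)) (*-congʳ (poch-snoc d b₋ μ)))) ⟨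
          X₀ ^ j * (pochᵈ b₋ m * X₊)
            ≈⟨ *-congˡ (poch-symmetric (+ d) m) ⟩
          X₀ ^ j * (X₀ * X₀)
            ≈⟨ solve 2 (λ x y → y :* (x :* x) := x :* (x :* y)) refl X₀ (X₀ ^ j) ⟩
          X₀ ^ suc (suc j) ∎
          where
          X₀ = pochᵈ (+ d) m
          X₊ = pochᵈ b₊ m
          X₋ = pochᵈ b₋ μ

        -- Doubling keeps the formula for an arithmetic progression free of halves.
        double-progression : ∀ b k → progressionSum d b k ℤ.+ progressionSum d b k ≡ + k ℤ.* (b ℤ.+ b ℤ.+ + d ℤ.* (+ k ℤ.- + 1))
        double-progression b zero    = ≡.refl
        double-progression b (suc k) = ≡.trans (regroup b (progressionSum d (b ℤ.+ + d) k))
          (≡.trans (≡.cong (λ x → b ℤ.+ b ℤ.+ x) (double-progression (b ℤ.+ + d) k)) (identity b (+ d) (+ k)))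
          where
          regroup : ∀ b x → b ℤ.+ x ℤ.+ (b ℤ.+ x) ≡ b ℤ.+ b ℤ.+ (x ℤ.+ x)
          regroup = solve-∀
          identity : ∀ b d k → b ℤ.+ b ℤ.+ k ℤ.* (b ℤ.+ d ℤ.+ (b ℤ.+ d) ℤ.+ d ℤ.* (k ℤ.- + 1))
            ≡ (+ 1 ℤ.+ k) ℤ.* (b ℤ.+ b ℤ.+ d ℤ.* (+ 1 ℤ.+ k ℤ.- + 1))
          identity = solve-∀

        -- The summand 1 - d comes from 1 - q^{1-d} = -q^{1-d} (1 - q^{d-1}). Twice the left-hand
        -- side is d(d-1)m(m+1) - 2.
        σ-value : ∀ e → suc e ℕ.+ suc e ≡ d ℕ.* (2 ℕ.+ j) ℕ.* m ℕ.* suc m → (+ 1 ℤ.- + d) ℤ.+ σ ≡ + e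
        σ-value e 2[e+1] = ℤₚ.*-cancelˡ-≡ (+ 2) _ _ (≡.trans (regroup (+ d) (+ j) S₀ S₊ S₋)
          (≡.trans (≡.cong₂ (λ x y → + 2 ℤ.* (+ 1 ℤ.- + d) ℤ.+ (+ j ℤ.* x ℤ.+ y)) (double-progression (+ d) m)
            (≡.cong₂ ℤ._+_ (double-progression b₊ m) (double-progression b₋ μ)))
          (≡.trans (≡.cong (λ x → + 2 ℤ.* (+ 1 ℤ.- + d) ℤ.+ (+ j ℤ.* (+ m ℤ.* (+ d ℤ.+ + d ℤ.+ + d ℤ.* (+ m ℤ.- + 1)))
                ℤ.+ (+ m ℤ.* (+ d ℤ.+ x ℤ.+ (+ d ℤ.+ x) ℤ.+ + d ℤ.* (+ m ℤ.- + 1))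
                ℤ.+ + μ ℤ.* (+ d ℤ.+ ℤ.- x ℤ.+ (+ d ℤ.+ ℤ.- x) ℤ.+ + d ℤ.* (+ μ ℤ.- + 1))))) +n)
          (≡.trans (identity (+ j) (+ μ)) (≡.trans (≡.cong (ℤ._- + 2) (≡.sym casted)) (halve (+ e)))))))
          where
          S₀ = progressionSum d (+ d) m
          S₊ = progressionSum d b₊ m
          S₋ = progressionSum d b₋ μ
          regroup : ∀ d j a b c → + 2 ℤ.* (+ 1 ℤ.- d ℤ.+ (j ℤ.* a ℤ.+ (b ℤ.+ (c ℤ.+ + 0))))
            ≡ + 2 ℤ.* (+ 1 ℤ.- d) ℤ.+ (j ℤ.* (a ℤ.+ a) ℤ.+ (b ℤ.+ b ℤ.+ (c ℤ.+ c)))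
          regroup = solve-∀
          identity : ∀ j μ → let d = + 3 ℤ.+ j; m = + 2 ℤ.+ μ; x = d ℤ.* m ℤ.- + 1 in
            + 2 ℤ.* (+ 1 ℤ.- d) ℤ.+ (j ℤ.* (m ℤ.* (d ℤ.+ d ℤ.+ d ℤ.* (m ℤ.- + 1)))
                ℤ.+ (m ℤ.* (d ℤ.+ x ℤ.+ (d ℤ.+ x) ℤ.+ d ℤ.* (m ℤ.- + 1))
                ℤ.+ μ ℤ.* (d ℤ.+ ℤ.- x ℤ.+ (d ℤ.+ ℤ.- x) ℤ.+ d ℤ.* (μ ℤ.- + 1))))
            ≡ d ℤ.* (+ 2 ℤ.+ j) ℤ.* m ℤ.* (+ 1 ℤ.+ m) ℤ.- + 2
          identity = solve-∀
          casted : + suc e ℤ.+ + suc e ≡ + d ℤ.* + (2 ℕ.+ j) ℤ.* + m ℤ.* + suc m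
          casted = ≡.trans (≡.cong +_ 2[e+1]) (≡.trans (ℤₚ.pos-* (d ℕ.* (2 ℕ.+ j) ℕ.* m) (suc m))
            (≡.cong (ℤ._* + suc m) (≡.trans (ℤₚ.pos-* (d ℕ.* (2 ℕ.+ j)) m) (≡.cong (ℤ._* + m) (ℤₚ.pos-* d (2 ℕ.+ j))))))
          halve : ∀ e → + 1 ℤ.+ e ℤ.+ (+ 1 ℤ.+ e) ℤ.- + 2 ≡ + 2 ℤ.* e
          halve = solve-∀

        sign-even : ∀ h → (- 1#) ^ (2 ℕ.* h) ≈ 1#
        sign-even h = trans (sym (^-assocʳ (- 1#) 2 h)) (trans (^-congˡ h square) (^-one h))
          where
          square : (- 1#) ^ 2 ≈ 1#
          square = solve 0 ((:- con (+ 1)) :* ((:- con (+ 1)) :* con (+ 1)) := con (+ 1)) refl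
          ^-one : ∀ h → 1# ^ h ≈ 1#
          ^-one zero    = refl
          ^-one (suc h) = trans (*-identityˡ _) (^-one h)

        -- N + m + 2 = n + 1 = d m is even; this is where the parity of d enters.
        sign : ∀ h → d ≡ 2 ℕ.* h → (- 1#) ^ N * (- 1#) ^ m ≈ 1#
        sign h d≡2h = begin
          (- 1#) ^ N * (- 1#) ^ m       ≈⟨ ^-homo-* (- 1#) N m ⟨
          (- 1#) ^ (N ℕ.+ m)            ≈⟨ solve 1 (λ x → x := (:- con (+ 1)) :* ((:- con (+ 1)) :* x)) refl _ ⟩
          (- 1#) ^ suc (suc (N ℕ.+ m))  ≡⟨ ≡.cong ((- 1#) ^_) even ⟩
          (- 1#) ^ (2 ℕ.* (h ℕ.* m))    ≈⟨ sign-even (h ℕ.* m) ⟩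
          1#                            ∎
          where
          even : suc (suc (N ℕ.+ m)) ≡ 2 ℕ.* (h ℕ.* m)
          even = ≡.trans (≡.cong suc (≡.sym n≡1+N+m)) (≡.trans n+1≡dm
            (≡.trans (≡.cong (ℕ._* m) d≡2h) (ℕₚ.*-assoc 2 h m)))

      -- The sign in κ and the one from reflecting 1 - q^{1-d} leave (-1)^{N+m} = 1. κ is given only
      -- up to `_≈_`, so that the caller may use the constant that occurs in `rhs`.
      evaluation : ∀ (t : ℕ → Carrier) e h κ →
        (∀ k → k ℕ.< n → t k * poch d (+ d) k ^ d
          ≈ poch d (+ suc d) k ^ suc (suc j) * poch d (+ 1 ℤ.- + d) k * E (+ (d ℕ.* k))) →
        suc e ℕ.+ suc e ≡ d ℕ.* (2 ℕ.+ j) ℕ.* m ℕ.* suc m → d ≡ 2 ℕ.* h → κ ≈ - (- 1#) ^ m →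
        Σ< n t * (κ * poch d (+ d) m ^ suc (suc j))
          ≈ oneMinus (+ 1) * oneMinus (+ suc (suc j)) * poch d (+ d) N * E (+ e)
      evaluation t e h κ t-eq 2[e+1] d≡2h κ≈ = begin
        Σ< n t * (κ * pochᵈ (+ d) m ^ suc (suc j))
          ≈⟨ *-congˡ (*-cong κ≈ (sym normalizer-*)) ⟩
        Σ< n t * (- s * (normalizer * (oneMinus (+ 1 ℤ.- + d) * oneMinus (+ 1))))
          ≈⟨ solve 5 (λ x s y u v → x :* ((:- s) :* (y :* (u :* v))) := (x :* y) :* ((:- s) :* (u :* v))) refl
               (Σ< n t) s normalizer (oneMinus (+ 1 ℤ.- + d)) (oneMinus (+ 1)) ⟩
        Σ< n t * normalizer * (- s * (oneMinus (+ 1 ℤ.- + d) * oneMinus (+ 1)))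
          ≈⟨ *-cong (normalized-sum t t-eq) (*-congˡ (*-congʳ reflected)) ⟩
        (- 1#) ^ N * E σ * pochᵈ (+ d) N * (- s * (- E (+ 1 ℤ.- + d) * oneMinus (+ suc (suc j)) * oneMinus (+ 1)))
          ≈⟨ solve 7 (λ r σ p s x u v → r :* σ :* p :* ((:- s) :* ((:- x) :* u :* v)) := r :* s :* (v :* u :* p :* (x :* σ))) refl
               ((- 1#) ^ N) (E σ) (pochᵈ (+ d) N) s (E (+ 1 ℤ.- + d)) (oneMinus (+ suc (suc j))) (oneMinus (+ 1)) ⟩
        (- 1#) ^ N * s * (oneMinus (+ 1) * oneMinus (+ suc (suc j)) * pochᵈ (+ d) N * (E (+ 1 ℤ.- + d) * E σ))
          ≈⟨ *-cong (sign h d≡2h) (*-congˡ (trans (sym (E-+ _ _)) (E-≡ (σ-value e 2[e+1])))) ⟩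
        1# * (oneMinus (+ 1) * oneMinus (+ suc (suc j)) * pochᵈ (+ d) N * E (+ e))
          ≈⟨ *-identityˡ _ ⟩
        oneMinus (+ 1) * oneMinus (+ suc (suc j)) * pochᵈ (+ d) N * E (+ e) ∎
        where
        s = (- 1#) ^ m
        unit-exponent : ∀ j → + 1 ℤ.- (+ 3 ℤ.+ j) ℤ.+ (+ 2 ℤ.+ j) ≡ + 0
        unit-exponent = solve-∀
        reflected : oneMinus (+ 1 ℤ.- + d) ≈ - E (+ 1 ℤ.- + d) * oneMinus (+ suc (suc j))
        reflected = begin
          1# + - x                              ≈⟨ +-congʳ (trans (sym E-0) (trans (E-≡ (≡.sym (unit-exponent (+ j)))) (E-+ _ _))) ⟩
          x * E (+ suc (suc j)) + - x           ≈⟨ solve 2 (λ x y → x :* y :- x := (:- x) :* (con (+ 1) :- y)) refl x _ ⟩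
          - x * oneMinus (+ suc (suc j))        ∎
          where
          x = E (+ 1 ℤ.- + d)

  -- Factors of q^n - 1

  -- `X k` stands for q^k, and `Φ` is an arbitrary sequence: what ties it to cyclotomic polynomials
  -- is `Factors`, obtained from the hypothesis `exact` below.
  module CyclotomicFactors {p} (C : Carrier → Set p) (C-1 : C 1#) (C-* : ∀ {x y} → C x → C y → C (x * y))
    (C-suc : ∀ k → C (fromℤ (+ suc k)))
    (X : ℕ → Carrier) (X-0 : X 0 ≈ 1#) (X-+ : ∀ a b → X (a ℕ.+ b) ≈ X a * X b)
    (X-cancel : ∀ g {x y} → (X (suc g) + - 1#) * x ≈ (X (suc g) + - 1#) * y → x ≈ y)
    (Φ : ℕ → Carrier) where

    open Coprimality C C-1 C-*

    ρ : ℕ → Carrier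
    ρ k = X k + - 1#

    -- G is 1 + q^a + ... + q^{(k-1)a}, a sum of k powers that are each 1 modulo q^a - 1. The value
    -- k is the source of the integer constants in the coprimality relations.
    ρ-geometric : ∀ a k → ∃[ G ] ∃[ W ] (ρ (k ℕ.* a) ≈ ρ a * G × G ≈ fromℤ (+ k) + ρ a * W)
    ρ-geometric a zero = 0# , 0# ,
      trans (+-congʳ X-0) (trans (-‿inverseʳ 1#) (sym (zeroʳ _))) ,
      sym (trans (+-identityˡ _) (zeroʳ _))
    ρ-geometric a (suc k) with ρ-geometric a k
    ... | G , W , ρ-eq , G-eq = X a * G + 1# , G + W ,
      (begin
        X (a ℕ.+ k ℕ.* a) + - 1#              ≈⟨ +-congʳ (X-+ a (k ℕ.* a)) ⟩
        X a * X (k ℕ.* a) + - 1#              ≈⟨ solve 2 (λ x y → x :* y :- con (+ 1) := x :* (y :- con (+ 1)) :+ (x :- con (+ 1))) refl (X a) _ ⟩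
        X a * ρ (k ℕ.* a) + ρ a               ≈⟨ +-congʳ (*-congˡ ρ-eq) ⟩
        X a * (ρ a * G) + ρ a                 ≈⟨ solve 3 (λ x y g → x :* (y :* g) :+ y := y :* (x :* g :+ con (+ 1))) refl (X a) (ρ a) G ⟩
        ρ a * (X a * G + 1#)                  ∎) ,
      (begin
        X a * G + 1#                          ≈⟨ solve 2 (λ x g → x :* g :+ con (+ 1) := con (+ 1) :+ g :+ (x :- con (+ 1)) :* g) refl (X a) G ⟩
        1# + G + ρ a * G                      ≈⟨ +-congʳ (+-congˡ G-eq) ⟩
        1# + (fromℤ (+ k) + ρ a * W) + ρ a * G ≈⟨ solve 4 (λ k y w g → con (+ 1) :+ (k :+ y :* w) :+ y :* g := con (+ 1) :+ k :+ y :* (g :+ w)) refl (fromℤ (+ k)) (ρ a) W G ⟩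
        1# + fromℤ (+ k) + ρ a * (G + W)      ≈⟨ +-congʳ (fromℤ-+ (+ 1) (+ k)) ⟨
        fromℤ (+ suc k) + ρ a * (G + W)       ∎)

    -- The Bézout identity of the exponents lifts through q^{g+u} - 1 = q^g (q^u - 1) + (q^g - 1).
    ρ-bézout : ∀ e j → ∃[ A ] ∃[ B ] (A * ρ e + B * ρ j ≈ ρ (gcd e j))
    ρ-bézout e j with Bézout.identity (gcd-GCD e j)
    ... | Bézout.+- x y eq with ρ-geometric e x | ρ-geometric j y
    ...   | G , _ , ρe-eq , _ | H , _ , ρj-eq , _ = G , - (X g * H) , (begin
      G * ρ e + - (X g * H) * ρ j                ≈⟨ solve 5 (λ g e x h j → g :* e :+ (:- (x :* h)) :* j := e :* g :- x :* (j :* h)) refl G (ρ e) (X g) H (ρ j) ⟩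
      ρ e * G + - (X g * (ρ j * H))              ≈⟨ +-cong ρe-eq (-‿cong (*-congˡ ρj-eq)) ⟨
      ρ (x ℕ.* e) + - (X g * ρ (y ℕ.* j))        ≡⟨ ≡.cong (λ k → ρ k + - (X g * ρ (y ℕ.* j))) eq ⟨
      ρ (g ℕ.+ y ℕ.* j) + - (X g * ρ (y ℕ.* j))  ≈⟨ +-congʳ (+-congʳ (X-+ g (y ℕ.* j))) ⟩
      (X g * X (y ℕ.* j) + - 1#) + - (X g * ρ (y ℕ.* j))
        ≈⟨ solve 2 (λ x y → (x :* y :- con (+ 1)) :- x :* (y :- con (+ 1)) := x :- con (+ 1)) refl (X g) (X (y ℕ.* j)) ⟩
      ρ g                                        ∎)
      where g = gcd e j
    ρ-bézout e j | Bézout.-+ x y eq with ρ-geometric e x | ρ-geometric j y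
    ...   | G , _ , ρe-eq , _ | H , _ , ρj-eq , _ = - (X g * G) , H , (begin
      - (X g * G) * ρ e + H * ρ j                ≈⟨ solve 5 (λ g e x h j → (:- (x :* g)) :* e :+ h :* j := j :* h :- x :* (e :* g)) refl G (ρ e) (X g) H (ρ j) ⟩
      ρ j * H + - (X g * (ρ e * G))              ≈⟨ +-cong ρj-eq (-‿cong (*-congˡ ρe-eq)) ⟨
      ρ (y ℕ.* j) + - (X g * ρ (x ℕ.* e))        ≡⟨ ≡.cong (λ k → ρ k + - (X g * ρ (x ℕ.* e))) eq ⟨
      ρ (g ℕ.+ x ℕ.* e) + - (X g * ρ (x ℕ.* e))  ≈⟨ +-congʳ (+-congʳ (X-+ g (x ℕ.* e))) ⟩
      (X g * X (x ℕ.* e) + - 1#) + - (X g * ρ (x ℕ.* e))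
        ≈⟨ solve 2 (λ x y → (x :* y :- con (+ 1)) :- x :* (y :- con (+ 1)) := x :- con (+ 1)) refl (X g) (X (x ℕ.* e)) ⟩
      ρ g                                        ∎)
      where g = gcd e j

    divisorFactor : ℕ → ℕ → Carrier
    divisorFactor n e with e ∣? n
    ... | yes _ = Φ e
    ... | no  _ = 1#

    -- The bound on the divisors is a separate argument: N = n - 1 gives the proper divisors, N = n
    -- all of them, and induction on N adds one factor at a time.
    divisorProduct : ℕ → ℕ → Carrier
    divisorProduct n zero    = 1#
    divisorProduct n (suc N) = divisorProduct n N * divisorFactor n (suc N)

    divisorProduct-∣ : ∀ {g f} N → g ∣ f → ∃[ K ] divisorProduct f N ≈ divisorProduct g N * K
    divisorProduct-∣ zero g∣f = 1# , sym (*-identityʳ 1#)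
    divisorProduct-∣ {g} {f} (suc N) g∣f with divisorProduct-∣ N g∣f | suc N ∣? g | suc N ∣? f
    ... | K , eq | yes _   | yes _   = K , trans (*-congʳ eq) (solve 3 (λ a k b → a :* k :* b := a :* b :* k) refl _ K _)
    ... | K , eq | yes e∣g | no e∤f  = contradiction (∣-trans e∣g g∣f) e∤f
    ... | K , eq | no _    | yes _   = K * Φ (suc N) , trans (*-congʳ eq) (solve 3 (λ a k b → a :* k :* b := a :* con (+ 1) :* (k :* b)) refl _ K _)
    ... | K , eq | no _    | no _    = K , trans (*-congʳ eq) (solve 2 (λ a k → a :* k :* con (+ 1) := a :* con (+ 1) :* k) refl _ K)

    divisorProduct-≤ : ∀ f N r → ∃[ K ] divisorProduct f (r ℕ.+ N) ≈ divisorProduct f N * K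
    divisorProduct-≤ f N zero    = 1# , sym (*-identityʳ _)
    divisorProduct-≤ f N (suc r) with divisorProduct-≤ f N r
    ... | K , eq = K * divisorFactor f (suc (r ℕ.+ N)) , trans (*-congʳ eq) (*-assoc _ _ _)

    -- q^n - 1 = ∏_{e ∣ n} Φ_e for n = i + 1.
    Factors : ℕ → Set ℓ
    Factors i = divisorProduct (suc i) i * Φ (suc i) ≈ ρ (suc i)

    factors-self : ∀ i → Factors i → divisorProduct (suc i) (suc i) ≈ ρ (suc i)
    factors-self i F with suc i ∣? suc i
    ... | yes _  = F
    ... | no n∤n = contradiction ∣-refl n∤n

    ρ-∣-divisorProduct : ∀ {g i} → Factors g → suc g ∣ suc i → g ℕ.< i → ∃[ K ] divisorProduct (suc i) i ≈ ρ (suc g) * K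
    ρ-∣-divisorProduct {g} {i} F g∣i g<i with divisorProduct-≤ (suc i) (suc g) (i ℕ.∸ suc g) | divisorProduct-∣ (suc g) g∣i
    ... | K , eq | L , eq′ = L * K , (begin
      divisorProduct (suc i) i                            ≡⟨ ≡.cong (divisorProduct (suc i)) (ℕₚ.m∸n+n≡m g<i) ⟨
      divisorProduct (suc i) (i ℕ.∸ suc g ℕ.+ suc g)      ≈⟨ eq ⟩
      divisorProduct (suc i) (suc g) * K                  ≈⟨ *-congʳ eq′ ⟩
      divisorProduct (suc g) (suc g) * L * K              ≈⟨ *-congʳ (*-congʳ (factors-self g F)) ⟩
      ρ (suc g) * L * K                                   ≈⟨ *-assoc _ _ _ ⟩
      ρ (suc g) * (L * K)                                 ∎)

    -- Φ_n divides (q^n - 1)/(q^g - 1), which is n/g modulo q^g - 1, where g = gcd(n, j).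
    coprime-ρ : ∀ i j → (∀ {k} → k ℕ.≤ i → Factors k) → ¬ suc i ∣ j → Coprime (Φ (suc i)) (ρ j)
    coprime-ρ i j F i∤j with gcd (suc i) j in g≡ | gcd[m,n]∣m (suc i) j | gcd[m,n]∣n (suc i) j | ρ-bézout (suc i) j
    ... | zero  | divides k eq | _ | _ = contradiction (≡.trans eq (ℕₚ.*-zeroʳ k)) λ()
    ... | suc g | divides zero () | _ | _
    ... | suc g | g∣i@(divides (suc k) eq) | g∣j | A , B , bez
        with ρ-geometric (suc g) (suc k) | ρ-∣-divisorProduct (F (ℕₚ.<⇒≤ g<i)) g∣i g<i
      where
      g≢i : g ≢ i
      g≢i ≡.refl = i∤j g∣j
      g<i : g ℕ.< i
      g<i = ℕₚ.≤∧≢⇒< (ℕₚ.≤-pred (∣⇒≤ g∣i)) g≢i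
    -- With g the gcd, K Φ_n = (q^n - 1)/(q^g - 1) = n/g + (q^g - 1) W. Subtracting W times the
    -- Bézout expression for q^g - 1, in which q^n - 1 is D Φ_n, leaves n/g.
    ... | G , W , ρ-eq , G-eq | K , D-eq = K + - (W * A * D) , - (W * B) , fromℤ (+ suc k) , C-suc k , (begin
      (K + - (W * A * D)) * Φ (suc i) + - (W * B) * ρ j
        ≈⟨ solve 7 (λ k w a d φ b r → (k :- w :* a :* d) :* φ :+ (:- (w :* b)) :* r := k :* φ :- w :* (a :* (d :* φ) :+ b :* r))
             refl K W A D (Φ (suc i)) B (ρ j) ⟩
      K * Φ (suc i) + - (W * (A * (D * Φ (suc i)) + B * ρ j))
        ≈⟨ +-cong KΦ≈G (-‿cong (*-congˡ (trans (+-congʳ (*-congˡ (F ℕₚ.≤-refl))) bez))) ⟩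
      G + - (W * ρ (suc g))
        ≈⟨ +-congʳ G-eq ⟩
      fromℤ (+ suc k) + ρ (suc g) * W + - (W * ρ (suc g))
        ≈⟨ solve 3 (λ k r w → k :+ r :* w :- w :* r := k) refl (fromℤ (+ suc k)) (ρ (suc g)) W ⟩
      fromℤ (+ suc k) ∎)
      where
      D = divisorProduct (suc i) i
      KΦ≈G : K * Φ (suc i) ≈ G
      KΦ≈G = X-cancel g (begin
        ρ (suc g) * (K * Φ (suc i))   ≈⟨ *-assoc _ _ _ ⟨
        ρ (suc g) * K * Φ (suc i)     ≈⟨ *-congʳ D-eq ⟨
        D * Φ (suc i)                 ≈⟨ F ℕₚ.≤-refl ⟩
        ρ (suc i)                     ≡⟨ ≡.cong ρ eq ⟩
        ρ (suc k ℕ.* suc g)           ≈⟨ ρ-eq ⟩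
        ρ (suc g) * G                 ∎)

    Φ-∣-ρ : ∀ {i} k → Factors i → ∃[ K ] Φ (suc i) * K ≈ ρ (k ℕ.* suc i)
    Φ-∣-ρ {i} k F with ρ-geometric (suc i) k
    ... | G , _ , eq , _ = divisorProduct (suc i) i * G ,
      trans (solve 3 (λ f d g → f :* (d :* g) := d :* f :* g) refl _ _ G) (trans (*-congʳ F) (sym eq))

    -- Each factor Φ_k with k ≤ e divides q^k - 1, which is coprime to Φ_{e+1} because e + 1 cannot
    -- divide the smaller k.
    coprime-divisorProduct : ∀ n e M → (∀ {k} → k ℕ.≤ e → Factors k) → M ℕ.≤ e → Coprime (Φ (suc e)) (divisorProduct n M)
    coprime-divisorProduct n e zero    F M≤e = Coprime-sym Coprime-1
    coprime-divisorProduct n e (suc M) F M<e =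
      Coprime-sym (Coprime-* (Coprime-sym (coprime-divisorProduct n e M F (ℕₚ.<⇒≤ M<e))) factor)
      where
      factor : Coprime (divisorFactor n (suc M)) (Φ (suc e))
      factor with suc M ∣? n
      ... | no _  = Coprime-1
      ... | yes _ with Φ-∣-ρ 1 (F (ℕₚ.<⇒≤ M<e))
      ...   | K , eq = Coprime-∣ K eq (Coprime-sym
        (≡.subst (λ j → Coprime (Φ (suc e)) (ρ j)) (≡.sym (ℕₚ.*-identityˡ (suc M)))
          (coprime-ρ e (suc M) F (λ e∣M → ℕₚ.<⇒≱ (s≤s M<e) (∣⇒≤ e∣M)))))

    -- Two coprime divisors of q^n - 1 have a product that divides it, up to the constant of their
    -- Bézout relation; these constants accumulate in `e`.
    divisorProduct-∣-ρ : ∀ i → (∀ {k} → k ℕ.< i → Factors k) → ∀ N → N ℕ.≤ i →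
      ∃[ Q ] ∃[ e ] (C e × divisorProduct (suc i) N * Q ≈ e * ρ (suc i))
    divisorProduct-∣-ρ i F zero    N≤i = ρ (suc i) , 1# , C-1 , refl
    divisorProduct-∣-ρ i F (suc N) N<i with divisorProduct-∣-ρ i F N (ℕₚ.<⇒≤ N<i) | suc N ∣? suc i
    ... | Q , e , Ce , eq | no _  = Q , e , Ce , trans (*-congʳ (*-identityʳ _)) eq
    ... | Q , e , Ce , eq | yes (divides k i≡)
        with Φ-∣-ρ k (F N<i) | coprime-divisorProduct (suc i) N N (λ k≤N → F (ℕₚ.≤-<-trans k≤N N<i)) ℕₚ.≤-refl
    ...   | K , eq′ | S , T , e′ , Ce′ , cop = S * Q + T * e * K , e′ * e , C-* Ce′ Ce , (begin
      D * φ * (S * Q + T * e * K)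
        ≈⟨ solve 7 (λ d φ s q t e k → d :* φ :* (s :* q :+ t :* e :* k) := s :* φ :* (d :* q) :+ t :* d :* (e :* (φ :* k)))
             refl D φ S Q T e K ⟩
      S * φ * (D * Q) + T * D * (e * (φ * K))
        ≈⟨ +-cong (*-congˡ eq) (*-congˡ (*-congˡ (trans eq′ (reflexive (≡.cong ρ (≡.sym i≡)))))) ⟩
      S * φ * (e * ρ (suc i)) + T * D * (e * ρ (suc i))
        ≈⟨ solve 6 (λ s φ e r t d → s :* φ :* (e :* r) :+ t :* d :* (e :* r) := (s :* φ :+ t :* d) :* e :* r) refl S φ e (ρ (suc i)) T D ⟩
      (S * φ + T * D) * e * ρ (suc i)
        ≈⟨ *-congʳ (*-congʳ cop) ⟩
      e′ * e * ρ (suc i) ∎)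
      where
      D = divisorProduct (suc i) N
      φ = Φ (suc N)

    -- `exact` removes the constant from the divisibility. That depends on how `Φ` is constructed,
    -- so it is left to the concrete polynomials.
    module _ (exact : ∀ i → ∃[ Q ] ∃[ e ] (C e × divisorProduct (suc i) i * Q ≈ e * ρ (suc i)) → Factors i) where

      factors : ∀ i → Factors i
      factors = <-rec Factors (λ i F → exact i (divisorProduct-∣-ρ i (λ k<i → F k<i) i ℕₚ.≤-refl))

      coprime-Φ-ρ : ∀ i j → ¬ suc i ∣ j → Coprime (Φ (suc i)) (ρ j)
      coprime-Φ-ρ i j = coprime-ρ i j (λ {k} _ → factors k)

      coprime-X-Φ : ∀ i k → Coprime (X k) (Φ (suc i))
      coprime-X-Φ i zero    = Coprime-congˡ X-0 Coprime-1
      coprime-X-Φ i (suc k) = Coprime-congˡ (X-+ 1 k) (Coprime-* X₁ (coprime-X-Φ i k))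
        where
        X₁ : Coprime (X 1) (Φ (suc i))
        -- The witnesses are q · q^{n-1} - (q^n - 1) = 1, with q^n - 1 factored.
        X₁ = X i , - divisorProduct (suc i) i , 1# , C-1 , (begin
          X i * X 1 + - divisorProduct (suc i) i * Φ (suc i)
            ≈⟨ solve 4 (λ x y d f → x :* y :+ (:- d) :* f := y :* x :- d :* f) refl (X i) (X 1) (divisorProduct (suc i) i) (Φ (suc i)) ⟩
          X 1 * X i + - (divisorProduct (suc i) i * Φ (suc i))
            ≈⟨ +-cong (sym (X-+ 1 i)) (-‿cong (factors i)) ⟩
          X (suc i) + - ρ (suc i)
            ≈⟨ solve 1 (λ x → x :- (x :- con (+ 1)) := con (+ 1)) refl (X (suc i)) ⟩
          1# ∎)

-- Integer power series and polynomials

open ≡.≡-Reasoning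

Series : Set
Series = ℕ → ℤ

-- The Cauchy product, recursing on the first factor as `_*ₚ_` does.
conv : Series → Series → Series
conv f g zero    = f 0 ℤ.* g 0
conv f g (suc i) = f 0 ℤ.* g (suc i) ℤ.+ conv (f ∘ suc) g i

conv-cong : ∀ {f f′ g g′} i → (∀ j → j ℕ.≤ i → f j ≡ f′ j) → (∀ j → j ℕ.≤ i → g j ≡ g′ j) → conv f g i ≡ conv f′ g′ i
conv-cong zero    f≡ g≡ = ≡.cong₂ ℤ._*_ (f≡ 0 z≤n) (g≡ 0 z≤n)
conv-cong (suc i) f≡ g≡ = ≡.cong₂ ℤ._+_ (≡.cong₂ ℤ._*_ (f≡ 0 z≤n) (g≡ (suc i) ℕₚ.≤-refl))
  (conv-cong i (λ j j≤i → f≡ (suc j) (s≤s j≤i)) (λ j j≤i → g≡ j (ℕₚ.m≤n⇒m≤1+n j≤i)))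

conv-tail : ∀ f g i → conv f g (suc i) ≡ conv f (g ∘ suc) i ℤ.+ f (suc i) ℤ.* g 0
conv-tail f g zero    = ≡.refl
conv-tail f g (suc i) = ≡.trans (≡.cong (λ x → f 0 ℤ.* g (suc (suc i)) ℤ.+ x) (conv-tail (f ∘ suc) g i))
  (≡.sym (ℤₚ.+-assoc (f 0 ℤ.* g (suc (suc i))) _ _))

conv-comm : ∀ f g i → conv f g i ≡ conv g f i
conv-comm f g zero    = ℤₚ.*-comm (f 0) (g 0)
conv-comm f g (suc i) = begin
  f 0 ℤ.* g (suc i) ℤ.+ conv (f ∘ suc) g i   ≡⟨ ℤₚ.+-comm _ (conv (f ∘ suc) g i) ⟩
  conv (f ∘ suc) g i ℤ.+ f 0 ℤ.* g (suc i)   ≡⟨ ≡.cong₂ ℤ._+_ (conv-comm (f ∘ suc) g i) (ℤₚ.*-comm (f 0) (g (suc i))) ⟩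
  conv g (f ∘ suc) i ℤ.+ g (suc i) ℤ.* f 0   ≡⟨ conv-tail g f i ⟨
  conv g f (suc i)                           ∎

conv-zeroˡ : ∀ g i → conv (λ _ → + 0) g i ≡ + 0
conv-zeroˡ g zero    = ℤₚ.*-zeroˡ (g 0)
conv-zeroˡ g (suc i) = ≡.cong₂ ℤ._+_ (ℤₚ.*-zeroˡ (g (suc i))) (conv-zeroˡ g i)

conv-+ : ∀ f f′ g i → conv (λ j → f j ℤ.+ f′ j) g i ≡ conv f g i ℤ.+ conv f′ g i
conv-+ f f′ g zero    = ℤₚ.*-distribʳ-+ (g 0) (f 0) (f′ 0)
conv-+ f f′ g (suc i) = ≡.trans (≡.cong₂ ℤ._+_ (ℤₚ.*-distribʳ-+ (g (suc i)) (f 0) (f′ 0)) (conv-+ (f ∘ suc) (f′ ∘ suc) g i))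
  (interchange (f 0 ℤ.* g (suc i)) (f′ 0 ℤ.* g (suc i)) (conv (f ∘ suc) g i) (conv (f′ ∘ suc) g i))
  where
  interchange : ∀ a b c d → a ℤ.+ b ℤ.+ (c ℤ.+ d) ≡ a ℤ.+ c ℤ.+ (b ℤ.+ d)
  interchange = solve-∀

conv-scale : ∀ a f g i → conv (λ j → a ℤ.* f j) g i ≡ a ℤ.* conv f g i
conv-scale a f g zero    = ℤₚ.*-assoc a (f 0) (g 0)
conv-scale a f g (suc i) = ≡.trans (≡.cong₂ ℤ._+_ (ℤₚ.*-assoc a (f 0) (g (suc i))) (conv-scale a (f ∘ suc) g i))
  (≡.sym (ℤₚ.*-distribˡ-+ a _ _))

conv-assoc : ∀ f g h i → conv (conv f g) h i ≡ conv f (conv g h) i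
conv-assoc f g h zero    = ℤₚ.*-assoc (f 0) (g 0) (h 0)
conv-assoc f g h (suc i) = begin
  f 0 ℤ.* g 0 ℤ.* h (suc i) ℤ.+ conv (λ j → f 0 ℤ.* g (suc j) ℤ.+ conv (f ∘ suc) g j) h i
    ≡⟨ ≡.cong₂ ℤ._+_ (ℤₚ.*-assoc (f 0) (g 0) (h (suc i))) (≡.trans (conv-+ _ (conv (f ∘ suc) g) h i)
         (≡.cong₂ ℤ._+_ (conv-scale (f 0) (g ∘ suc) h i) (conv-assoc (f ∘ suc) g h i))) ⟩
  f 0 ℤ.* (g 0 ℤ.* h (suc i)) ℤ.+ (f 0 ℤ.* conv (g ∘ suc) h i ℤ.+ conv (f ∘ suc) (conv g h) i)
    ≡⟨ regroup (f 0) _ _ _ ⟩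
  f 0 ℤ.* conv g h (suc i) ℤ.+ conv (f ∘ suc) (conv g h) i ∎
  where
  regroup : ∀ a x y z → a ℤ.* x ℤ.+ (a ℤ.* y ℤ.+ z) ≡ a ℤ.* (x ℤ.+ y) ℤ.+ z
  regroup = solve-∀

-- The constant term of `D` is a unit, so f(0) = 0; then f is divided by q and the argument repeats.
conv-regular : ∀ D f i → D 0 ℤ.* D 0 ≡ + 1 → (∀ j → j ℕ.≤ i → conv D f j ≡ + 0) → f i ≡ + 0
conv-regular D f i D₀² conv≡0 = go f i conv≡0
  where
  head : ∀ f → D 0 ℤ.* f 0 ≡ + 0 → f 0 ≡ + 0
  head f eq = begin
    f 0                     ≡⟨ ℤₚ.*-identityˡ (f 0) ⟨
    + 1 ℤ.* f 0             ≡⟨ ≡.cong (ℤ._* f 0) D₀² ⟨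
    D 0 ℤ.* D 0 ℤ.* f 0     ≡⟨ ℤₚ.*-assoc (D 0) (D 0) (f 0) ⟩
    D 0 ℤ.* (D 0 ℤ.* f 0)   ≡⟨ ≡.cong (D 0 ℤ.*_) eq ⟩
    D 0 ℤ.* + 0             ≡⟨ ℤₚ.*-zeroʳ (D 0) ⟩
    + 0                     ∎
  go : ∀ f i → (∀ j → j ℕ.≤ i → conv D f j ≡ + 0) → f i ≡ + 0
  go f zero    eq = head f (eq 0 z≤n)
  go f (suc i) eq = go (f ∘ suc) i λ j j≤i → begin
    conv D (f ∘ suc) j                          ≡⟨ ℤₚ.+-identityʳ _ ⟨
    conv D (f ∘ suc) j ℤ.+ + 0                  ≡⟨ ≡.cong (λ x → conv D (f ∘ suc) j ℤ.+ x) (ℤₚ.*-zeroʳ (D (suc j))) ⟨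
    conv D (f ∘ suc) j ℤ.+ D (suc j) ℤ.* + 0    ≡⟨ ≡.cong (λ x → conv D (f ∘ suc) j ℤ.+ D (suc j) ℤ.* x) (head f (eq 0 z≤n)) ⟨
    conv D (f ∘ suc) j ℤ.+ D (suc j) ℤ.* f 0    ≡⟨ conv-tail D f j ⟨
    conv D f (suc j)                            ≡⟨ eq (suc j) (s≤s j≤i) ⟩
    + 0                                         ∎

conv-cancel : ∀ D f g → D 0 ℤ.* D 0 ≡ + 1 → (∀ i → conv D f i ≡ conv D g i) → ∀ i → f i ≡ g i
conv-cancel D f g D₀² eq i = ℤₚ.i-j≡0⇒i≡j (f i) (g i) (≡.trans (difference (f i) (g i))
  (conv-regular D (λ j → f j ℤ.+ ℤ.-1ℤ ℤ.* g j) i D₀² λ j _ → begin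
    conv D (λ j → f j ℤ.+ ℤ.-1ℤ ℤ.* g j) j              ≡⟨ conv-comm D _ j ⟩
    conv (λ j → f j ℤ.+ ℤ.-1ℤ ℤ.* g j) D j              ≡⟨ conv-+ f (λ j → ℤ.-1ℤ ℤ.* g j) D j ⟩
    conv f D j ℤ.+ conv (λ j → ℤ.-1ℤ ℤ.* g j) D j       ≡⟨ ≡.cong₂ ℤ._+_ (≡.trans (conv-comm f D j) (≡.trans (eq j) (conv-comm D g j))) (conv-scale ℤ.-1ℤ g D j) ⟩
    conv g D j ℤ.+ ℤ.-1ℤ ℤ.* conv g D j                 ≡⟨ opposite (conv g D j) ⟩
    + 0                                                 ∎))
  where
  difference : ∀ x y → x ℤ.- y ≡ x ℤ.+ -[1+ 0 ] ℤ.* y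
  difference = solve-∀
  opposite : ∀ x → x ℤ.+ -[1+ 0 ] ℤ.* x ≡ + 0
  opposite = solve-∀

conv-vanish : ∀ f g i → (∀ j → j ℕ.≤ i → g j ≡ + 0) → conv f g i ≡ + 0
conv-vanish f g i g≡0 = ≡.trans (conv-cong {g′ = λ _ → + 0} i (λ _ _ → ≡.refl) g≡0)
  (≡.trans (conv-comm f (λ _ → + 0) i) (conv-zeroˡ f i))

conv-top : ∀ f g a b → (∀ i → a ℕ.< i → f i ≡ + 0) → (∀ i → b ℕ.< i → g i ≡ + 0) → conv f g (a ℕ.+ b) ≡ f a ℤ.* g b
conv-top f g zero    zero    f≡0 g≡0 = ≡.refl
conv-top f g zero    (suc b) f≡0 g≡0 = ≡.trans
  (≡.cong (λ x → f 0 ℤ.* g (suc b) ℤ.+ x)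
    (≡.trans (conv-comm (f ∘ suc) g b) (conv-vanish g (f ∘ suc) b (λ j _ → f≡0 (suc j) (s≤s z≤n)))))
  (ℤₚ.+-identityʳ _)
conv-top f g (suc a) b f≡0 g≡0 = ≡.trans
  (≡.cong₂ ℤ._+_ (≡.trans (≡.cong (f 0 ℤ.*_) (g≡0 _ (s≤s (ℕₚ.m≤n+m b a)))) (ℤₚ.*-zeroʳ (f 0)))
    (conv-top (f ∘ suc) g a b (λ i a<i → f≡0 (suc i) (s≤s a<i)) g≡0))
  (ℤₚ.+-identityˡ _)

degree : ∀ (f : Series) L → f 0 ≢ + 0 → (∀ i → L ℕ.≤ i → f i ≡ + 0) → ∃[ a ] (f a ≢ + 0 × (∀ i → a ℕ.< i → f i ≡ + 0))
degree f zero    f₀≢0 f≡0 = contradiction (f≡0 0 z≤n) f₀≢0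
degree f (suc L) f₀≢0 f≡0 with f L ℤ.≟ + 0
... | no fL≢0  = L , fL≢0 , f≡0
... | yes fL≡0 = degree f L f₀≢0 λ i L≤i → [ f≡0 i , (λ { ≡.refl → fL≡0 }) ]′ (ℕₚ.m≤n⇒m<n∨m≡n L≤i)

-- The bound K on the support of `s` is lowered one by one: while K > n, the top coefficient of `D`
-- times s(K) is the coefficient of the product at an index above n, hence zero.
quotient-degree : ∀ D s n L → D 0 ≢ + 0 → (∀ i → L ℕ.≤ i → D i ≡ + 0) → (∀ i → n ℕ.< i → conv D s i ≡ + 0) →
  ∀ K → (∀ i → K ℕ.≤ i → s i ≡ + 0) → ∀ i → n ℕ.< i → s i ≡ + 0
quotient-degree D s n L D₀≢0 D≡0 prod≡0 zero    s≡0 i n<i = s≡0 i z≤n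
quotient-degree D s n L D₀≢0 D≡0 prod≡0 (suc K) s≡0 with K ℕₚ.≤? n
... | yes K≤n = λ i n<i → s≡0 i (ℕₚ.≤-<-trans K≤n n<i)
... | no  K≰n = quotient-degree D s n L D₀≢0 D≡0 prod≡0 K λ i K≤i →
    [ s≡0 i , (λ { ≡.refl → sK≡0 }) ]′ (ℕₚ.m≤n⇒m<n∨m≡n K≤i)
  where
  sK≡0 : s K ≡ + 0
  sK≡0 with degree D L D₀≢0 D≡0
  ... | a , Da≢0 , D>a≡0 with ℤₚ.i*j≡0⇒i≡0∨j≡0 (D a)
        (≡.trans (≡.sym (conv-top D s a K D>a≡0 s≡0)) (prod≡0 _ (ℕₚ.≤-trans (ℕₚ.≰⇒> K≰n) (ℕₚ.m≤n+m K a))))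
  ...   | inj₁ Da≡0 = contradiction Da≡0 Da≢0
  ...   | inj₂ sK≡0 = sK≡0

-- The ring ℤ[q] through coefficients

coeff-+ₚ : ∀ p q i → coeff (p +ₚ q) i ≡ coeff p i ℤ.+ coeff q i
coeff-+ₚ []      q       i       = ≡.sym (ℤₚ.+-identityˡ _)
coeff-+ₚ (a ∷ p) []      i       = ≡.sym (ℤₚ.+-identityʳ _)
coeff-+ₚ (a ∷ p) (b ∷ q) zero    = ≡.refl
coeff-+ₚ (a ∷ p) (b ∷ q) (suc i) = coeff-+ₚ p q i

coeff-negₚ : ∀ p i → coeff (negₚ p) i ≡ ℤ.- coeff p i
coeff-negₚ []      i       = ≡.refl
coeff-negₚ (a ∷ p) zero    = ≡.refl
coeff-negₚ (a ∷ p) (suc i) = coeff-negₚ p i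

coeff-scale : ∀ a p i → coeff (map (a ℤ.*_) p) i ≡ a ℤ.* coeff p i
coeff-scale a []      i       = ≡.sym (ℤₚ.*-zeroʳ a)
coeff-scale a (b ∷ p) zero    = ≡.refl
coeff-scale a (b ∷ p) (suc i) = coeff-scale a p i

coeff-*ₚ : ∀ p q i → coeff (p *ₚ q) i ≡ conv (coeff p) (coeff q) i
coeff-*ₚ []      q i       = ≡.sym (conv-zeroˡ (coeff q) i)
coeff-*ₚ (a ∷ p) q zero    = ≡.trans (coeff-+ₚ (map (a ℤ.*_) q) _ 0)
  (≡.trans (≡.cong (ℤ._+ + 0) (coeff-scale a q 0)) (ℤₚ.+-identityʳ _))
coeff-*ₚ (a ∷ p) q (suc i) = ≡.trans (coeff-+ₚ (map (a ℤ.*_) q) _ (suc i))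
  (≡.cong₂ ℤ._+_ (coeff-scale a q (suc i)) (coeff-*ₚ p q i))

coeff-length : ∀ p i → length p ℕ.≤ i → coeff p i ≡ + 0
coeff-length []      i       _         = ≡.refl
coeff-length (a ∷ p) (suc i) (s≤s p≤i) = coeff-length p i p≤i

-- _≈ₚ_ in a record, from which the two polynomials can be inferred.
infix 4 _≋_
record _≋_ (p q : Poly) : Set where
  constructor coefficientwise
  field at : p ≈ₚ q
open _≋_ public

coeff-0 : ∀ i → coeff (constₚ (+ 0)) i ≡ + 0
coeff-0 zero    = ≡.refl
coeff-0 (suc i) = ≡.refl

conv-oneₚ : ∀ f i → conv (coeff oneₚ) f i ≡ f i
conv-oneₚ f zero    = ℤₚ.*-identityˡ (f 0)
conv-oneₚ f (suc i) = ≡.trans (≡.cong₂ ℤ._+_ (ℤₚ.*-identityˡ (f (suc i))) (conv-zeroˡ f i)) (ℤₚ.+-identityʳ _)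

-- The zero is the list with one entry 0 rather than the empty list, because `sumᵣ` starts from it;
-- sums in the fraction ring then agree with `sumᵣ` literally.
polyRing : CommutativeRing 0ℓ 0ℓ
polyRing = record
  { Carrier = Poly ; _≈_ = _≋_ ; _+_ = _+ₚ_ ; _*_ = _*ₚ_ ; -_ = negₚ ; 0# = constₚ (+ 0) ; 1# = oneₚ
  ; isCommutativeRing = record
    { isRing = record
      { +-isAbelianGroup = record
        { isGroup = record
          { isMonoid = record
            { isSemigroup = record
              { isMagma = record
                { isEquivalence = record
                  { refl  = coefficientwise λ i → ≡.refl
                  ; sym   = λ eq → coefficientwise λ i → ≡.sym (at eq i)
                  ; trans = λ eq eq′ → coefficientwise λ i → ≡.trans (at eq i) (at eq′ i) }
                ; ∙-cong = λ {p} {p′} {q} {q′} eq eq′ → coefficientwise λ i → ≡.trans (coeff-+ₚ p q i)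
                    (≡.trans (≡.cong₂ ℤ._+_ (at eq i) (at eq′ i)) (≡.sym (coeff-+ₚ p′ q′ i))) }
              ; assoc = λ p q r → coefficientwise λ i → begin
                  coeff (p +ₚ q +ₚ r) i                    ≡⟨ ≡.trans (coeff-+ₚ (p +ₚ q) r i) (≡.cong (ℤ._+ coeff r i) (coeff-+ₚ p q i)) ⟩
                  coeff p i ℤ.+ coeff q i ℤ.+ coeff r i    ≡⟨ ℤₚ.+-assoc (coeff p i) (coeff q i) (coeff r i) ⟩
                  coeff p i ℤ.+ (coeff q i ℤ.+ coeff r i)  ≡⟨ ≡.trans (coeff-+ₚ p (q +ₚ r) i) (≡.cong (λ x → coeff p i ℤ.+ x) (coeff-+ₚ q r i)) ⟨
                  coeff (p +ₚ (q +ₚ r)) i                  ∎ }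
            ; identity =
                (λ p → coefficientwise λ i → ≡.trans (coeff-+ₚ (constₚ (+ 0)) p i) (≡.trans (≡.cong (ℤ._+ coeff p i) (coeff-0 i)) (ℤₚ.+-identityˡ _)))
              , (λ p → coefficientwise λ i → ≡.trans (coeff-+ₚ p (constₚ (+ 0)) i) (≡.trans (≡.cong (λ x → coeff p i ℤ.+ x) (coeff-0 i)) (ℤₚ.+-identityʳ _))) }
          ; inverse =
              (λ p → coefficientwise λ i → ≡.trans (coeff-+ₚ (negₚ p) p i)
                (≡.trans (≡.cong (ℤ._+ coeff p i) (coeff-negₚ p i)) (≡.trans (ℤₚ.+-inverseˡ (coeff p i)) (≡.sym (coeff-0 i)))))
            , (λ p → coefficientwise λ i → ≡.trans (coeff-+ₚ p (negₚ p) i)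
                (≡.trans (≡.cong (λ x → coeff p i ℤ.+ x) (coeff-negₚ p i)) (≡.trans (ℤₚ.+-inverseʳ (coeff p i)) (≡.sym (coeff-0 i)))))
          ; ⁻¹-cong = λ {p} {q} eq → coefficientwise λ i →
              ≡.trans (coeff-negₚ p i) (≡.trans (≡.cong ℤ.-_ (at eq i)) (≡.sym (coeff-negₚ q i))) }
        ; comm = λ p q → coefficientwise λ i →
            ≡.trans (coeff-+ₚ p q i) (≡.trans (ℤₚ.+-comm (coeff p i) (coeff q i)) (≡.sym (coeff-+ₚ q p i))) }
      ; *-cong = λ {p} {p′} {q} {q′} eq eq′ → coefficientwise λ i → ≡.trans (coeff-*ₚ p q i)
          (≡.trans (conv-cong i (λ j _ → at eq j) (λ j _ → at eq′ j)) (≡.sym (coeff-*ₚ p′ q′ i)))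
      ; *-assoc = λ p q r → coefficientwise λ i → begin
          coeff (p *ₚ q *ₚ r) i                          ≡⟨ ≡.trans (coeff-*ₚ (p *ₚ q) r i) (conv-cong i (λ j _ → coeff-*ₚ p q j) (λ _ _ → ≡.refl)) ⟩
          conv (conv (coeff p) (coeff q)) (coeff r) i    ≡⟨ conv-assoc (coeff p) (coeff q) (coeff r) i ⟩
          conv (coeff p) (conv (coeff q) (coeff r)) i    ≡⟨ ≡.trans (coeff-*ₚ p (q *ₚ r) i) (conv-cong i (λ _ _ → ≡.refl) (λ j _ → coeff-*ₚ q r j)) ⟨
          coeff (p *ₚ (q *ₚ r)) i                        ∎
      ; *-identity = *-identityˡ , λ p → coefficientwise λ i → ≡.trans (at (*-comm p oneₚ) i) (at (*-identityˡ p) i)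
      ; distrib = (λ p q r → coefficientwise λ i → begin
            coeff (p *ₚ (q +ₚ r)) i                   ≡⟨ at (*-comm p (q +ₚ r)) i ⟩
            coeff ((q +ₚ r) *ₚ p) i                   ≡⟨ at (*-distribʳ p q r) i ⟩
            coeff (q *ₚ p +ₚ r *ₚ p) i                ≡⟨ coeff-+ₚ (q *ₚ p) (r *ₚ p) i ⟩
            coeff (q *ₚ p) i ℤ.+ coeff (r *ₚ p) i     ≡⟨ ≡.cong₂ ℤ._+_ (at (*-comm q p) i) (at (*-comm r p) i) ⟩
            coeff (p *ₚ q) i ℤ.+ coeff (p *ₚ r) i     ≡⟨ coeff-+ₚ (p *ₚ q) (p *ₚ r) i ⟨
            coeff (p *ₚ q +ₚ p *ₚ r) i                ∎)
          , *-distribʳ }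
    ; *-comm = *-comm } }
  where
  *-comm : ∀ p q → p *ₚ q ≋ q *ₚ p
  *-comm p q = coefficientwise λ i →
    ≡.trans (coeff-*ₚ p q i) (≡.trans (conv-comm (coeff p) (coeff q) i) (≡.sym (coeff-*ₚ q p i)))
  *-identityˡ : ∀ p → oneₚ *ₚ p ≋ p
  *-identityˡ p = coefficientwise λ i → ≡.trans (coeff-*ₚ oneₚ p i) (conv-oneₚ (coeff p) i)
  *-distribʳ : ∀ p q r → (q +ₚ r) *ₚ p ≋ q *ₚ p +ₚ r *ₚ p
  *-distribʳ p q r = coefficientwise λ i → begin
    coeff ((q +ₚ r) *ₚ p) i                                        ≡⟨ coeff-*ₚ (q +ₚ r) p i ⟩
    conv (coeff (q +ₚ r)) (coeff p) i                              ≡⟨ conv-cong i (λ j _ → coeff-+ₚ q r j) (λ _ _ → ≡.refl) ⟩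
    conv (λ j → coeff q j ℤ.+ coeff r j) (coeff p) i               ≡⟨ conv-+ (coeff q) (coeff r) (coeff p) i ⟩
    conv (coeff q) (coeff p) i ℤ.+ conv (coeff r) (coeff p) i      ≡⟨ ≡.cong₂ ℤ._+_ (coeff-*ₚ q p i) (coeff-*ₚ r p i) ⟨
    coeff (q *ₚ p) i ℤ.+ coeff (r *ₚ p) i                          ≡⟨ coeff-+ₚ (q *ₚ p) (r *ₚ p) i ⟨
    coeff (q *ₚ p +ₚ r *ₚ p) i                                     ∎

private
  module Pr = CommutativeRing polyRing

-- Power series division

length-seriesDiv : ∀ N D L → length (seriesDiv N D L) ≡ L
length-seriesDiv N D zero    = ≡.refl
length-seriesDiv N D (suc L) = ≡.trans (Listₚ.length-++ (seriesDiv N D L))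
  (≡.trans (ℕₚ.+-comm _ 1) (≡.cong suc (length-seriesDiv N D L)))

coeff-++ : ∀ p q i → i ℕ.< length p → coeff (p ++ q) i ≡ coeff p i
coeff-++ (a ∷ p) q zero    _         = ≡.refl
coeff-++ (a ∷ p) q (suc i) (s≤s i<p) = coeff-++ p q i i<p

coeff-∷ʳ : ∀ p a → coeff (p ++ a ∷ []) (length p) ≡ a
coeff-∷ʳ []      a = ≡.refl
coeff-∷ʳ (b ∷ p) a = coeff-∷ʳ p a

-- The full power series N / D, each coefficient read off from the first truncation that reaches it.
quotient : Poly → Poly → Series
quotient N D i = coeff (seriesDiv N D (suc i)) i

coeff-seriesDiv : ∀ N D L i → i ℕ.< L → coeff (seriesDiv N D L) i ≡ quotient N D i
coeff-seriesDiv N D (suc L) i i<1+L with ℕₚ.m≤n⇒m<n∨m≡n (ℕₚ.≤-pred i<1+L)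
... | inj₂ ≡.refl = ≡.refl
... | inj₁ i<L    = ≡.trans
  (coeff-++ (seriesDiv N D L) _ i (≡.subst (i ℕ.<_) (≡.sym (length-seriesDiv N D L)) i<L))
  (coeff-seriesDiv N D L i i<L)

conv-sum : ∀ f g i → sumℤ (map (λ j → f j ℤ.* g (i ∸ j)) (upTo (suc i))) ≡ conv f g i
conv-sum f g i = ≡.trans (≡.cong sumℤ (Listₚ.map-upTo (λ j → f j ℤ.* g (i ∸ j)) (suc i))) (go f i)
  where
  go : ∀ f i → sumℤ (applyUpTo (λ j → f j ℤ.* g (i ∸ j)) (suc i)) ≡ conv f g i
  go f zero    = ℤₚ.+-identityʳ _
  go f (suc i) = ≡.cong (λ x → f 0 ℤ.* g (suc i) ℤ.+ x) (go (f ∘ suc) i)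

quotient-step : ∀ N D i → quotient N D i ≡ coeff D 0 ℤ.* (coeff N i ℤ.-
  sumℤ (map (λ j → coeff D (suc j) ℤ.* coeff (seriesDiv N D i) (i ∸ suc j)) (upTo i)))
quotient-step N D i = ≡.subst (λ l → coeff (seriesDiv N D i ++ x ∷ []) l ≡ x) (length-seriesDiv N D i)
  (coeff-∷ʳ (seriesDiv N D i) x)
  where
  x = coeff D 0 ℤ.* (coeff N i ℤ.-
    sumℤ (map (λ j → coeff D (suc j) ℤ.* coeff (seriesDiv N D i) (i ∸ suc j)) (upTo i)))

-- When D(0)² = 1, the multiplication by D(0) in `seriesDiv` is the division by D(0) that the
-- recursion calls for.
quotient-conv : ∀ N D → coeff D 0 ℤ.* coeff D 0 ≡ + 1 → ∀ i → conv (coeff D) (quotient N D) i ≡ coeff N i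
quotient-conv N D D₀² zero = begin
  d ℤ.* (d ℤ.* (coeff N 0 ℤ.- + 0))   ≡⟨ regroup d (coeff N 0) ⟩
  d ℤ.* d ℤ.* coeff N 0               ≡⟨ ≡.cong (ℤ._* coeff N 0) D₀² ⟩
  + 1 ℤ.* coeff N 0                   ≡⟨ ℤₚ.*-identityˡ _ ⟩
  coeff N 0                           ∎
  where
  d = coeff D 0
  regroup : ∀ d x → d ℤ.* (d ℤ.* (x ℤ.- + 0)) ≡ d ℤ.* d ℤ.* x
  regroup = solve-∀
quotient-conv N D D₀² (suc i) = begin
  d ℤ.* quotient N D (suc i) ℤ.+ y                ≡⟨ ≡.cong (λ x → d ℤ.* x ℤ.+ y) (quotient-step N D (suc i)) ⟩
  d ℤ.* (d ℤ.* (coeff N (suc i) ℤ.- S)) ℤ.+ y     ≡⟨ ≡.cong (λ s → d ℤ.* (d ℤ.* (coeff N (suc i) ℤ.- s)) ℤ.+ y) S≡y ⟩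
  d ℤ.* (d ℤ.* (coeff N (suc i) ℤ.- y)) ℤ.+ y     ≡⟨ regroup d (coeff N (suc i)) y ⟩
  d ℤ.* d ℤ.* (coeff N (suc i) ℤ.- y) ℤ.+ y       ≡⟨ ≡.cong (λ x → x ℤ.* (coeff N (suc i) ℤ.- y) ℤ.+ y) D₀² ⟩
  + 1 ℤ.* (coeff N (suc i) ℤ.- y) ℤ.+ y           ≡⟨ cancelling (coeff N (suc i)) y ⟩
  coeff N (suc i)                                 ∎
  where
  d = coeff D 0
  y = conv (coeff D ∘ suc) (quotient N D) i
  S = sumℤ (map (λ j → coeff D (suc j) ℤ.* coeff (seriesDiv N D (suc i)) (i ∸ j)) (upTo (suc i)))
  S≡y : S ≡ y
  S≡y = ≡.trans (≡.cong sumℤ (Listₚ.map-cong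
      (λ j → ≡.cong (coeff D (suc j) ℤ.*_) (coeff-seriesDiv N D (suc i) (i ∸ j) (s≤s (ℕₚ.m∸n≤m i j)))) (upTo (suc i))))
    (conv-sum (coeff D ∘ suc) (quotient N D) i)
  regroup : ∀ d x y → d ℤ.* (d ℤ.* (x ℤ.- y)) ℤ.+ y ≡ d ℤ.* d ℤ.* (x ℤ.- y) ℤ.+ y
  regroup = solve-∀
  cancelling : ∀ x y → + 1 ℤ.* (x ℤ.- y) ℤ.+ y ≡ x
  cancelling = solve-∀

-- The recursion that defines the cyclotomic polynomials

properDivisors-range : ∀ n → All (λ e → 1 ℕ.≤ e × e ℕ.< n) (properDivisors n)
properDivisors-range n = Allₚ.filter⁺ (λ e → e ∣? n) (Allₚ.map⁺ (All.map
  (λ k<n-1 → s≤s z≤n , below n k<n-1) (Allₚ.all-upTo (n ∸ 1))))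
  where
  below : ∀ n {k} → k ℕ.< n ∸ 1 → suc k ℕ.< n
  below (suc n) k<n = s≤s k<n

-- Recursive calls go to proper divisors, which are smaller, so any fuel above n suffices.
cycloF-fuel : ∀ f g n → n ℕ.< f → n ℕ.< g → cycloF f n ≡ cycloF g n
cycloF-fuel (suc f) (suc g) n (s≤s n≤f) (s≤s n≤g) =
  ≡.cong (λ es → seriesDiv (X^ n -ₚ oneₚ) (prodₚ es) (suc n)) (Listₚ.map-cong-local (All.map
    (λ (_ , e<n) → cycloF-fuel f g _ (ℕₚ.<-≤-trans e<n n≤f) (ℕₚ.<-≤-trans e<n n≤g)) (properDivisors-range n)))

properProduct : ℕ → Poly
properProduct n = prodₚ (map Φ (properDivisors n))

Φ-unfold : ∀ n → Φ n ≡ seriesDiv (X^ n -ₚ oneₚ) (properProduct n) (suc n)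
Φ-unfold n = ≡.cong (λ es → seriesDiv (X^ n -ₚ oneₚ) (prodₚ es) (suc n)) (Listₚ.map-cong-local (All.map
  (λ {e} (_ , e<n) → cycloF-fuel n (suc e) e e<n (ℕₚ.n<1+n e)) (properDivisors-range n)))

coeff₀-* : ∀ p q → coeff (p *ₚ q) 0 ≡ coeff p 0 ℤ.* coeff q 0
coeff₀-* p q = coeff-*ₚ p q 0

-- Constant term ±1, in a form that is visibly multiplicative and that `quotient-conv` uses
-- directly.
SignedConstant : Poly → Set
SignedConstant p = coeff p 0 ℤ.* coeff p 0 ≡ + 1

signedConstant-* : ∀ p q → SignedConstant p → SignedConstant q → SignedConstant (p *ₚ q)
signedConstant-* p q p₀² q₀² = begin
  coeff (p *ₚ q) 0 ℤ.* coeff (p *ₚ q) 0           ≡⟨ ≡.cong₂ ℤ._*_ (coeff₀-* p q) (coeff₀-* p q) ⟩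
  a ℤ.* b ℤ.* (a ℤ.* b)                           ≡⟨ regroup a b ⟩
  a ℤ.* a ℤ.* (b ℤ.* b)                           ≡⟨ ≡.cong₂ ℤ._*_ p₀² q₀² ⟩
  + 1                                             ∎
  where
  a = coeff p 0
  b = coeff q 0
  regroup : ∀ a b → a ℤ.* b ℤ.* (a ℤ.* b) ≡ a ℤ.* a ℤ.* (b ℤ.* b)
  regroup = solve-∀

signedConstant-prodₚ : ∀ {ps} → All SignedConstant ps → SignedConstant (prodₚ ps)
signedConstant-prodₚ []                       = ≡.refl
signedConstant-prodₚ (_∷_ {x = p} {xs = ps} s ss) = signedConstant-* p (prodₚ ps) s (signedConstant-prodₚ ss)

coeff-X^-above : ∀ n i → n ℕ.< i → coeff (X^ n) i ≡ + 0
coeff-X^-above zero    (suc i) _         = ≡.refl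
coeff-X^-above (suc n) (suc i) (s≤s n<i) = coeff-X^-above n i n<i

coeff-X^-1 : ∀ n i → coeff (X^ n -ₚ oneₚ) i ≡ coeff (X^ n) i ℤ.- coeff oneₚ i
coeff-X^-1 n i = ≡.trans (coeff-+ₚ (X^ n) (negₚ oneₚ) i) (≡.cong (λ x → coeff (X^ n) i ℤ.+ x) (coeff-negₚ oneₚ i))

coeff-X^-1-above : ∀ n i → n ℕ.< i → coeff (X^ n -ₚ oneₚ) i ≡ + 0
coeff-X^-1-above n (suc i) n<i = ≡.trans (coeff-X^-1 n (suc i)) (≡.trans (ℤₚ.+-identityʳ _) (coeff-X^-above n (suc i) n<i))

-- Φ_n(0) is minus the constant term of the product over the proper divisors, as q^n - 1 has
-- constant term -1.
signedConstant-Φ : ∀ n → 1 ℕ.≤ n → SignedConstant (Φ n)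
signedConstant-Φ = <-rec (λ n → 1 ℕ.≤ n → SignedConstant (Φ n)) step
  where
  step : ∀ n → (∀ {e} → e ℕ.< n → 1 ℕ.≤ e → SignedConstant (Φ e)) → 1 ℕ.≤ n → SignedConstant (Φ n)
  step (suc n) rec _ = ≡.subst (λ x → x ℤ.* x ≡ + 1) (≡.sym Φ₀)
    (≡.trans (regroup d) (signedConstant-prodₚ (Allₚ.map⁺ (All.map (λ (1≤e , e<n) → rec e<n 1≤e) (properDivisors-range (suc n))))))
    where
    d = coeff (properProduct (suc n)) 0
    Φ₀ : coeff (Φ (suc n)) 0 ≡ d ℤ.* -[1+ 0 ]
    Φ₀ = ≡.trans (≡.cong (λ p → coeff p 0) (Φ-unfold (suc n)))
      (coeff-seriesDiv (X^ (suc n) -ₚ oneₚ) (properProduct (suc n)) (suc (suc n)) 0 (s≤s z≤n))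
    regroup : ∀ d → d ℤ.* -[1+ 0 ] ℤ.* (d ℤ.* -[1+ 0 ]) ≡ d ℤ.* d
    regroup = solve-∀

signedConstant-properProduct : ∀ n → SignedConstant (properProduct n)
signedConstant-properProduct n = signedConstant-prodₚ (Allₚ.map⁺ (All.map (λ (1≤e , _) → signedConstant-Φ _ 1≤e) (properDivisors-range n)))

signedConstant-nonzero : ∀ p → SignedConstant p → coeff p 0 ≢ + 0
signedConstant-nonzero p s p₀≡0 with ≡.trans (≡.sym s) (≡.cong (λ x → x ℤ.* x) p₀≡0)
... | ()

NonzeroConstant : Poly → Set
NonzeroConstant p = ∃[ c ] (c ≢ + 0 × p ≋ constₚ c)

constₚ-* : ∀ a b → constₚ a *ₚ constₚ b ≋ constₚ (a ℤ.* b)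
constₚ-* a b = coefficientwise λ where
  zero          → ℤₚ.+-identityʳ _
  (suc zero)    → ≡.refl
  (suc (suc i)) → ≡.refl

nonzeroConstant-1 : NonzeroConstant oneₚ
nonzeroConstant-1 = + 1 , (λ ()) , Pr.refl

nonzeroConstant-* : ∀ {p q} → NonzeroConstant p → NonzeroConstant q → NonzeroConstant (p *ₚ q)
nonzeroConstant-* (a , a≢0 , p≋a) (b , b≢0 , q≋b) = a ℤ.* b ,
  (λ ab≡0 → [ a≢0 , b≢0 ]′ (ℤₚ.i*j≡0⇒i≡0∨j≡0 a ab≡0)) ,
  Pr.trans (Pr.*-cong p≋a q≋b) (constₚ-* a b)

open IntegerSolver polyRing using (fromℤ; fromℤ-+)

fromℤ-constₚ : ∀ k → fromℤ (+ k) ≋ constₚ (+ k)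
fromℤ-constₚ zero    = Pr.refl
fromℤ-constₚ (suc k) = Pr.trans (fromℤ-+ (+ 1) (+ k)) (Pr.+-congˡ {x = oneₚ} (fromℤ-constₚ k))

nonzeroConstant-suc : ∀ k → NonzeroConstant (fromℤ (+ suc k))
nonzeroConstant-suc k = + suc k , (λ ()) , fromℤ-constₚ (suc k)

shift-*ₚ : ∀ p q → (+ 0 ∷ p) *ₚ q ≋ + 0 ∷ (p *ₚ q)
shift-*ₚ p q = coefficientwise λ where
  zero    → ≡.trans (coeff-*ₚ (+ 0 ∷ p) q 0) (ℤₚ.*-zeroˡ (coeff q 0))
  (suc i) → ≡.trans (coeff-*ₚ (+ 0 ∷ p) q (suc i)) (≡.trans
    (≡.cong₂ ℤ._+_ (ℤₚ.*-zeroˡ (coeff q (suc i))) (≡.sym (coeff-*ₚ p q i))) (ℤₚ.+-identityˡ _))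

X^-+ : ∀ a b → X^ (a ℕ.+ b) ≋ X^ a *ₚ X^ b
X^-+ zero    b = Pr.sym (Pr.*-identityˡ (X^ b))
X^-+ (suc a) b = Pr.trans (coefficientwise λ { zero → ≡.refl ; (suc i) → at (X^-+ a b) i }) (Pr.sym (shift-*ₚ (X^ a) (X^ b)))

regular-*ₚ : ∀ D {p q} → SignedConstant D → D *ₚ p ≋ D *ₚ q → p ≋ q
regular-*ₚ D {p} {q} s eq = coefficientwise (conv-cancel (coeff D) (coeff p) (coeff q) s
  λ i → ≡.trans (≡.sym (coeff-*ₚ D p i)) (≡.trans (at eq i) (coeff-*ₚ D q i)))

open OverRing.CyclotomicFactors polyRing NonzeroConstant nonzeroConstant-1 nonzeroConstant-* nonzeroConstant-suc
  X^ Pr.refl X^-+ (λ g → regular-*ₚ (X^ (suc g) -ₚ oneₚ) ≡.refl) Φ public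

-- Exactness of the division that defines Φ_n

prodₚ-++ : ∀ ps qs → prodₚ (ps ++ qs) ≋ prodₚ ps *ₚ prodₚ qs
prodₚ-++ []       qs = Pr.sym (Pr.*-identityˡ (prodₚ qs))
prodₚ-++ (p ∷ ps) qs = Pr.trans (Pr.*-congˡ {x = p} (prodₚ-++ ps qs)) (Pr.sym (Pr.*-assoc p (prodₚ ps) (prodₚ qs)))

prodₚ-divisors : ∀ n N → prodₚ (map Φ (filter (λ e → e ∣? n) (map suc (upTo N)))) ≋ divisorProduct n N
prodₚ-divisors n zero    = Pr.refl
prodₚ-divisors n (suc N) = Pr.trans (Pr.reflexive (≡.cong prodₚ split))
  (Pr.trans (prodₚ-++ (map Φ (divisors N)) _) (Pr.*-cong (prodₚ-divisors n N) last))
  where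
  divisors : ℕ → List ℕ
  divisors N = filter (λ e → e ∣? n) (map suc (upTo N))
  split : map Φ (divisors (suc N)) ≡ map Φ (divisors N) ++ map Φ (filter (λ e → e ∣? n) (suc N ∷ []))
  split = begin
    map Φ (divisors (suc N))
      ≡⟨ ≡.cong (λ l → map Φ (filter (λ e → e ∣? n) (map suc l))) (Listₚ.upTo-∷ʳ N) ⟨
    map Φ (filter (λ e → e ∣? n) (map suc (upTo N ++ N ∷ [])))
      ≡⟨ ≡.cong (λ l → map Φ (filter (λ e → e ∣? n) l)) (Listₚ.map-++ suc (upTo N) (N ∷ [])) ⟩
    map Φ (filter (λ e → e ∣? n) (map suc (upTo N) ++ suc N ∷ []))
      ≡⟨ ≡.cong (map Φ) (Listₚ.filter-++ (λ e → e ∣? n) (map suc (upTo N)) (suc N ∷ [])) ⟩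
    map Φ (divisors N ++ filter (λ e → e ∣? n) (suc N ∷ []))
      ≡⟨ Listₚ.map-++ Φ (divisors N) _ ⟩
    map Φ (divisors N) ++ map Φ (filter (λ e → e ∣? n) (suc N ∷ [])) ∎
  last : prodₚ (map Φ (filter (λ e → e ∣? n) (suc N ∷ []))) ≋ divisorFactor n (suc N)
  last with suc N ∣? n
  ... | yes e∣n = Pr.trans (Pr.reflexive (≡.cong (λ l → prodₚ (map Φ l)) (Listₚ.filter-accept (λ e → e ∣? n) e∣n))) (Pr.*-identityʳ (Φ (suc N)))
  ... | no  e∤n = Pr.reflexive (≡.cong (λ l → prodₚ (map Φ l)) (Listₚ.filter-reject (λ e → e ∣? n) e∤n))

constₚ-scale : ∀ c p j → coeff (constₚ c *ₚ p) j ≡ c ℤ.* coeff p j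
constₚ-scale c p j = ≡.trans (coeff-+ₚ (map (c ℤ.*_) p) (constₚ (+ 0)) j)
  (≡.trans (≡.cong₂ ℤ._+_ (coeff-scale c p j) (coeff-0 j)) (ℤₚ.+-identityʳ _))

-- Q and c · N / D agree as power series, so N / D is a polynomial, of degree at most that of N.
exact-seriesDiv : ∀ N D n Q c → SignedConstant D → c ≢ + 0 → (∀ j → n ℕ.< j → coeff N j ≡ + 0) →
  D *ₚ Q ≋ constₚ c *ₚ N → D *ₚ seriesDiv N D (suc n) ≋ N
exact-seriesDiv N D n Q c D₀² c≢0 N-degree DQ≋cN = coefficientwise λ j → begin
  coeff (D *ₚ φ) j              ≡⟨ coeff-*ₚ D φ j ⟩
  conv (coeff D) (coeff φ) j    ≡⟨ conv-cong j (λ _ _ → ≡.refl) (λ l _ → coeff-φ l) ⟩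
  conv (coeff D) s j            ≡⟨ quotient-conv N D D₀² j ⟩
  coeff N j                     ∎
  where
  φ = seriesDiv N D (suc n)
  s = quotient N D
  Q≡cs : ∀ j → coeff Q j ≡ c ℤ.* s j
  Q≡cs = conv-cancel (coeff D) (coeff Q) (λ j → c ℤ.* s j) D₀² λ j → begin
    conv (coeff D) (coeff Q) j                ≡⟨ coeff-*ₚ D Q j ⟨
    coeff (D *ₚ Q) j                          ≡⟨ at DQ≋cN j ⟩
    coeff (constₚ c *ₚ N) j                   ≡⟨ constₚ-scale c N j ⟩
    c ℤ.* coeff N j                           ≡⟨ ≡.cong (c ℤ.*_) (quotient-conv N D D₀² j) ⟨
    c ℤ.* conv (coeff D) s j                  ≡⟨ ≡.cong (c ℤ.*_) (conv-comm (coeff D) s j) ⟩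
    c ℤ.* conv s (coeff D) j                  ≡⟨ conv-scale c s (coeff D) j ⟨
    conv (λ j → c ℤ.* s j) (coeff D) j        ≡⟨ conv-comm _ (coeff D) j ⟩
    conv (coeff D) (λ j → c ℤ.* s j) j        ∎
  s-bounded : ∀ j → length Q ℕ.≤ j → s j ≡ + 0
  s-bounded j Q≤j = [ (λ c≡0 → contradiction c≡0 c≢0) , (λ sj≡0 → sj≡0) ]′
    (ℤₚ.i*j≡0⇒i≡0∨j≡0 c (≡.trans (≡.sym (Q≡cs j)) (coeff-length Q j Q≤j)))
  s-degree : ∀ j → n ℕ.< j → s j ≡ + 0
  s-degree = quotient-degree (coeff D) s n (length D) (signedConstant-nonzero D D₀²) (coeff-length D)
    (λ j n<j → ≡.trans (quotient-conv N D D₀² j) (N-degree j n<j)) (length Q) s-bounded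
  coeff-φ : ∀ j → coeff φ j ≡ s j
  coeff-φ j with j ℕₚ.<? suc n
  ... | yes j<1+n = coeff-seriesDiv N D (suc n) j j<1+n
  ... | no  j≮1+n = ≡.trans
    (coeff-length φ j (≡.subst (ℕ._≤ j) (≡.sym (length-seriesDiv N D (suc n))) (ℕₚ.≮⇒≥ j≮1+n)))
    (≡.sym (s-degree j (ℕₚ.≮⇒≥ j≮1+n)))

exact-division : ∀ i → ∃[ Q ] ∃[ e ] (NonzeroConstant e × divisorProduct (suc i) i *ₚ Q ≋ e *ₚ ρ (suc i)) → Factors i
exact-division i (Q , e , (c , c≢0 , e≋c) , DQ≋eρ) = ≡.subst (λ φ → divisorProduct (suc i) i *ₚ φ ≋ ρ (suc i)) (≡.sym (Φ-unfold (suc i)))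
  (Pr.trans (Pr.*-congʳ {x = seriesDiv (ρ (suc i)) D (suc (suc i))} (Pr.sym D≋))
    (exact-seriesDiv (ρ (suc i)) D (suc i) Q c (signedConstant-properProduct (suc i)) c≢0 (coeff-X^-1-above (suc i))
      (Pr.trans (Pr.*-congʳ {x = Q} D≋) (Pr.trans DQ≋eρ (Pr.*-congʳ {x = ρ (suc i)} e≋c)))))
  where
  D = properProduct (suc i)
  D≋ : D ≋ divisorProduct (suc i) i
  D≋ = prodₚ-divisors (suc i) i

-- The congruence

open OverRing.Coprimality polyRing NonzeroConstant nonzeroConstant-1 nonzeroConstant-*

module Congruence (n : ℕ) (φ D : Poly) (Dφ≋ : D *ₚ φ ≋ X^ n -ₚ oneₚ)
  (coprime-X : ∀ k → Coprime (X^ k) φ) (coprime-X-1 : ∀ k → ¬ n ∣ k → Coprime φ (X^ k -ₚ oneₚ)) where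

  open OverRing.FractionRing polyRing NonzeroConstant nonzeroConstant-1 nonzeroConstant-* (φ *ₚ φ)

  private
    module F = CommutativeRing fractionRing

  coprime-X² : ∀ k → Coprime (X^ k) (φ *ₚ φ)
  coprime-X² k = Coprime-square (coprime-X k)

  E : ℤ → Fraction
  E (+ k)    = mkFraction (X^ k , oneₚ) Coprime-1
  E -[1+ k ] = mkFraction (oneₚ , X^ (suc k)) (coprime-X² (suc k))

  E-⊖ : ∀ a b → E (a ℤ.⊖ b) ≃ mkFraction (X^ a , X^ b) (coprime-X² b)
  E-⊖ a       zero    = cross≃ Pr.refl
  E-⊖ zero    (suc b) = cross≃ Pr.refl
  E-⊖ (suc a) (suc b) = F.trans (F.reflexive (≡.cong E (ℤₚ.[1+m]⊖[1+n]≡m⊖n a b)))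
    (F.trans (E-⊖ a b) (cross≃ (Pr.trans (Pr.sym (X^-+ a (suc b)))
      (Pr.trans (Pr.reflexive (≡.cong X^ (ℕₚ.+-suc a b))) (X^-+ (suc a) b)))))

  E-+ : ∀ a b → E (a ℤ.+ b) ≃ E a ⊗ E b
  E-+ (+ a)    (+ b)    = cross≃ (Pr.trans (Pr.*-congˡ {x = X^ (a ℕ.+ b)} (Pr.*-identityˡ oneₚ)) (Pr.*-congʳ {x = oneₚ} (X^-+ a b)))
  E-+ (+ a)    -[1+ b ] = F.trans (E-⊖ a (suc b)) (cross≃ (Pr.trans (Pr.*-congˡ {x = X^ a} (Pr.*-identityˡ (X^ (suc b))))
    (Pr.*-congʳ {x = X^ (suc b)} (Pr.sym (Pr.*-identityʳ (X^ a))))))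
  E-+ -[1+ a ] (+ b)    = F.trans (E-⊖ b (suc a)) (cross≃ (Pr.trans (Pr.*-congˡ {x = X^ b} (Pr.*-identityʳ (X^ (suc a))))
    (Pr.*-congʳ {x = X^ (suc a)} (Pr.sym (Pr.*-identityˡ (X^ b))))))
  E-+ -[1+ a ] -[1+ b ] = cross≃ (Pr.*-cong (Pr.sym (Pr.*-identityˡ oneₚ))
    (Pr.trans (Pr.sym (X^-+ (suc a) (suc b))) (Pr.reflexive (≡.cong (X^ ∘ suc) (ℕₚ.+-suc a b)))))

  open OverRing.Summation fractionRing E (cross≃ Pr.refl) E-+
  open Powers F.commutativeSemiring using (_^_; ^-congˡ)

  -- Carries the very pair that `oneMinusQ` returns, whereas `oneMinus` represents the same ring
  -- element by another pair. The first serves the statement, the second the calculation.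
  oneMinusF : ℤ → Fraction
  oneMinusF (+ k)    = mkFraction (oneMinusQ (+ k)) Coprime-1
  oneMinusF -[1+ k ] = mkFraction (oneMinusQ -[1+ k ]) (coprime-X² (suc k))

  frac-oneMinusF : ∀ a → frac (oneMinusF a) ≡ oneMinusQ a
  frac-oneMinusF (+ k)    = ≡.refl
  frac-oneMinusF -[1+ k ] = ≡.refl

  oneMinusF≃ : ∀ a → oneMinusF a ≃ oneMinus a
  oneMinusF≃ (+ k)    = oneMinus-num (X^ k) _ _
  oneMinusF≃ -[1+ k ] = oneMinus-den (X^ (suc k)) _ _

  frac-Π< : ∀ {f g} k → (∀ i → frac (f i) ≡ g i) → frac (Π< k f) ≡ prodᵣ (map g (upTo k))
  frac-Π< {f} {g} k eq = ≡.trans (go k eq) (≡.cong prodᵣ (≡.sym (Listₚ.map-upTo g k)))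
    where
    go : ∀ {f g} k → (∀ i → frac (f i) ≡ g i) → frac (Π< k f) ≡ prodᵣ (applyUpTo g k)
    go zero    eq = ≡.refl
    go (suc k) eq = ≡.cong₂ _*ᵣ_ (eq 0) (go k (eq ∘ suc))

  frac-Σ< : ∀ {f g} k → (∀ i → i ℕ.< k → frac (f i) ≡ g i) → frac (Σ< k f) ≡ sumᵣ (map g (upTo k))
  frac-Σ< {f} {g} k eq = ≡.trans (go k eq) (≡.cong sumᵣ (≡.sym (Listₚ.map-upTo g k)))
    where
    go : ∀ {f g} k → (∀ i → i ℕ.< k → frac (f i) ≡ g i) → frac (Σ< k f) ≡ sumᵣ (applyUpTo g k)
    go zero    eq = ≡.refl
    go (suc k) eq = ≡.cong₂ _+ᵣ_ (eq 0 (s≤s z≤n)) (go k (λ i i<k → eq (suc i) (s≤s i<k)))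

  frac-^ : ∀ x {y} k → frac x ≡ y → frac (x ^ k) ≡ y ^ᵣ k
  frac-^ x zero    eq = ≡.refl
  frac-^ x (suc k) eq = ≡.cong₂ _*ᵣ_ eq (frac-^ x k eq)

  coprime-num-Π< : ∀ {f} k → (∀ i → i ℕ.< k → Coprime (num (f i)) (φ *ₚ φ)) → Coprime (num (Π< k f)) (φ *ₚ φ)
  coprime-num-Π< zero    co = Coprime-1
  coprime-num-Π< (suc k) co = Coprime-* (co 0 (s≤s z≤n)) (coprime-num-Π< k (λ i i<k → co (suc i) (s≤s i<k)))

  coprime-num-^ : ∀ {x} k → Coprime (num x) (φ *ₚ φ) → Coprime (num (x ^ k)) (φ *ₚ φ)
  coprime-num-^ zero    co = Coprime-1
  coprime-num-^ (suc k) co = Coprime-* co (coprime-num-^ k co)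

  coprime-1-X : ∀ k → ¬ n ∣ k → Coprime (oneₚ -ₚ X^ k) (φ *ₚ φ)
  coprime-1-X k n∤k = Coprime-square (Coprime-swap {oneₚ} {X^ k} (Coprime-sym (coprime-X-1 k n∤k)))

  -- (1 - q^n)² = φ² D²; this is where the square of Φ_n as modulus is used.
  ε²≃0 : oneMinus (+ n) ⊗ oneMinus (+ n) ≃ 0F
  ε²≃0 = F.trans (F.*-cong (F.sym (oneMinusF≃ (+ n))) (F.sym (oneMinusF≃ (+ n))))
    (≃0 {oneMinusF (+ n) ⊗ oneMinusF (+ n)} (D *ₚ D) square)
    where
    open IntegerSolver polyRing
    square : (oneₚ -ₚ X^ n) *ₚ (oneₚ -ₚ X^ n) ≋ φ *ₚ φ *ₚ (D *ₚ D)
    square = Pr.trans (solve 1 (λ x → (con (+ 1) :- x) :* (con (+ 1) :- x) := (x :- con (+ 1)) :* (x :- con (+ 1))) Pr.refl (X^ n))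
      (Pr.trans (Pr.*-cong (Pr.sym Dφ≋) (Pr.sym Dφ≋))
        (solve 2 (λ d f → d :* f :* (d :* f) := f :* f :* (d :* d)) Pr.refl D φ))

  module _ (j μ h e : ℕ) (n+1≡dm : suc n ≡ (3 ℕ.+ j) ℕ.* (2 ℕ.+ μ)) (d≡2h : 3 ℕ.+ j ≡ 2 ℕ.* h)
    (2[e+1] : suc e ℕ.+ suc e ≡ (3 ℕ.+ j) ℕ.* (2 ℕ.+ j) ℕ.* (2 ℕ.+ μ) ℕ.* (3 ℕ.+ μ)) where

    private
      d = 3 ℕ.+ j
      m = 2 ℕ.+ μ

    -- Multiply by m: since m d = n + 1, n would divide (n + 1)(i + 1), hence i + 1, which is
    -- smaller than n.
    n∤d[1+i] : ∀ i → suc i ℕ.< n → ¬ n ∣ d ℕ.+ d ℕ.* i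
    n∤d[1+i] i 1+i<n n∣ = ℕₚ.<⇒≱ 1+i<n (∣⇒≤ (∣m+n∣m⇒∣n (≡.subst (n ∣_) expand (∣n⇒∣m*n m n∣)) (m∣m*n (suc i))))
      where
      expand : m ℕ.* (d ℕ.+ d ℕ.* i) ≡ n ℕ.* suc i ℕ.+ suc i
      expand = begin
        m ℕ.* (d ℕ.+ d ℕ.* i)   ≡⟨ ≡.cong (m ℕ.*_) (ℕₚ.*-suc d i) ⟨
        m ℕ.* (d ℕ.* suc i)     ≡⟨ ℕₚ.*-assoc m d (suc i) ⟨
        m ℕ.* d ℕ.* suc i       ≡⟨ ≡.cong (ℕ._* suc i) (≡.trans (ℕₚ.*-comm m d) (≡.sym n+1≡dm)) ⟩
        suc i ℕ.+ n ℕ.* suc i   ≡⟨ ℕₚ.+-comm (suc i) (n ℕ.* suc i) ⟩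
        n ℕ.* suc i ℕ.+ suc i   ∎

    coprime-factor : ∀ i → suc i ℕ.< n → Coprime (num (oneMinusF (+ d ℤ.+ + (d ℕ.* i)))) (φ *ₚ φ)
    coprime-factor i 1+i<n = coprime-1-X (d ℕ.+ d ℕ.* i) (n∤d[1+i] i 1+i<n)

    unit : ∀ i → suc i ℕ.< n → ∃[ y ] oneMinus (+ d ℤ.+ + (d ℕ.* i)) ⊗ y ≃ 1F
    unit i 1+i<n = y , F.trans (F.*-congʳ {x = y} (F.sym (oneMinusF≃ (+ d ℤ.+ + (d ℕ.* i)))))
      (invert-inverseʳ (oneMinusF (+ d ℤ.+ + (d ℕ.* i))) (coprime-factor i 1+i<n))
      where y = invert (oneMinusF (+ d ℤ.+ + (d ℕ.* i))) (coprime-factor i 1+i<n)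

    open Evaluation j μ n n+1≡dm ε²≃0 unit

    pochF : ℤ → ℕ → Fraction
    pochF a k = Π< k (λ i → oneMinusF (a ℤ.+ + (d ℕ.* i)))

    pochF≃ : ∀ a k → pochF a k ≃ poch d a k
    pochF≃ a k = Π<-cong k (λ i → oneMinusF≃ (a ℤ.+ + (d ℕ.* i)))

    frac-pochF : ∀ a k → frac (pochF a k) ≡ qPoch a d k
    frac-pochF a k = frac-Π< k (λ i → frac-oneMinusF (a ℤ.+ + (d ℕ.* i)))

    coprime-pochF : ∀ k → k ℕ.< n → Coprime (num (pochF (+ d) k)) (φ *ₚ φ)
    coprime-pochF k k<n = coprime-num-Π< k (λ i i<k → coprime-factor i (ℕₚ.≤-<-trans i<k k<n))

    numerator : ℕ → Fraction
    numerator k = (pochF (+ suc d) k ^ (d ∸ 1)) ⊗ pochF (+ 1 ℤ.- + d) k ⊗ E (+ (d ℕ.* k))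

    coprime-denominator : ∀ k → k ℕ.< n → Coprime (num (pochF (+ d) k ^ d)) (φ *ₚ φ)
    coprime-denominator k k<n = coprime-num-^ {pochF (+ d) k} d (coprime-pochF k k<n)

    -- A denominator is known to be coprime to the modulus only for k < n. The value 0 elsewhere is
    -- a default, outside the range of summation.
    summand′ : ∀ k → Dec (k ℕ.< n) → Fraction
    summand′ k (yes k<n) = numerator k ⊗ invert (pochF (+ d) k ^ d) (coprime-denominator k k<n)
    summand′ k (no _)    = 0F

    summand : ℕ → Fraction
    summand k = summand′ k (k ℕₚ.<? n)

    summandᵣ : ℕ → RF
    summandᵣ k = ((qPoch (+ (suc d)) d k ^ᵣ (d ∸ 1)) *ᵣ qPoch (+ 1 ℤ.- + d) d k *ᵣ polyᵣ (X^ (d ℕ.* k))) /ᵣ (qPoch (+ d) d k ^ᵣ d)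

    frac-summand′ : ∀ k k<?n → k ℕ.< n → frac (summand′ k k<?n) ≡ summandᵣ k
    frac-summand′ k (no k≮n) k<n = contradiction k<n k≮n
    frac-summand′ k (yes _)  _   = ≡.cong₂ (λ x y → x *ᵣ invᵣ y)
      (≡.cong₂ (λ x y → x *ᵣ y *ᵣ polyᵣ (X^ (d ℕ.* k))) (frac-^ (pochF (+ suc d) k) (d ∸ 1) (frac-pochF (+ suc d) k)) (frac-pochF (+ 1 ℤ.- + d) k))
      (frac-^ (pochF (+ d) k) d (frac-pochF (+ d) k))

    frac-summand : ∀ k → k ℕ.< n → frac (summand k) ≡ summandᵣ k
    frac-summand k = frac-summand′ k (k ℕₚ.<? n)

    numerator≃ : ∀ k → numerator k ≃ (poch d (+ suc d) k ^ suc (suc j)) ⊗ poch d (+ 1 ℤ.- + d) k ⊗ E (+ (d ℕ.* k))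
    numerator≃ k = F.*-congʳ {x = E (+ (d ℕ.* k))} (F.*-cong (^-congˡ (suc (suc j)) (pochF≃ (+ suc d) k)) (pochF≃ (+ 1 ℤ.- + d) k))

    summand′-eq : ∀ k k<?n → k ℕ.< n → summand′ k k<?n ⊗ (poch d (+ d) k ^ d)
      ≃ (poch d (+ suc d) k ^ suc (suc j)) ⊗ poch d (+ 1 ℤ.- + d) k ⊗ E (+ (d ℕ.* k))
    summand′-eq k (no k≮n)   k<n = contradiction k<n k≮n
    summand′-eq k (yes k<n′) _   = F.trans
      (F.*-congˡ {x = numerator k ⊗ invert (pochF (+ d) k ^ d) (coprime-denominator k k<n′)} (F.sym (^-congˡ d (pochF≃ (+ d) k))))
      (F.trans (invert-cancel (numerator k) (pochF (+ d) k ^ d) (coprime-denominator k k<n′)) (numerator≃ k))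

    summand-eq : ∀ k → k ℕ.< n → summand k ⊗ (poch d (+ d) k ^ d)
      ≃ (poch d (+ suc d) k ^ suc (suc j)) ⊗ poch d (+ 1 ℤ.- + d) k ⊗ E (+ (d ℕ.* k))
    summand-eq k = summand′-eq k (k ℕₚ.<? n)

    signF : ℕ → Fraction
    signF k = mkFraction (constₚ (ℤ.-1ℤ ℤ.^ k) , oneₚ) Coprime-1

    signF≃ : ∀ k → signF k ≃ (⊖ 1F) ^ k
    signF≃ zero    = F.refl
    signF≃ (suc k) = F.trans
      (cross≃ {signF (suc k)} {⊖ 1F ⊗ signF k} (Pr.*-cong (Pr.sym (constₚ-* ℤ.-1ℤ (ℤ.-1ℤ ℤ.^ k))) (Pr.*-identityˡ oneₚ)))
      (F.*-congˡ {x = ⊖ 1F} (signF≃ k))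

    sign≢0 : ∀ k → ℤ.- (ℤ.-1ℤ ℤ.^ k) ≢ + 0
    sign≢0 k eq = nonzero k (≡.trans (≡.sym (ℤₚ.neg-involutive (ℤ.-1ℤ ℤ.^ k))) (≡.cong ℤ.-_ eq))
      where
      nonzero : ∀ k → ℤ.-1ℤ ℤ.^ k ≢ + 0
      nonzero zero    ()
      nonzero (suc k) eq = [ (λ ()) , nonzero k ]′ (ℤₚ.i*j≡0⇒i≡0∨j≡0 ℤ.-1ℤ eq)

    closedNum closedDen : Fraction
    closedNum = oneMinusF (+ 1) ⊗ oneMinusF (+ (d ∸ 1)) ⊗ pochF (+ d) (n ∸ 1 ∸ m) ⊗ E (+ e)
    closedDen = (⊖ signF m) ⊗ (pochF (+ d) m ^ (d ∸ 1))

    m<n : m ℕ.< n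
    m<n = ≡.subst (m ℕ.<_) (≡.sym n≡1+N+m) (s≤s (ℕₚ.m≤n+m m N))

    n-1-m≡N : n ∸ 1 ∸ m ≡ N
    n-1-m≡N = ≡.trans (≡.cong (λ x → x ∸ 1 ∸ m) n≡1+N+m) (ℕₚ.m+n∸n≡m N m)

    coprime-closedDen : Coprime (num closedDen) (φ *ₚ φ)
    coprime-closedDen = Coprime-* {constₚ (ℤ.- (ℤ.-1ℤ ℤ.^ m))} {num (pochF (+ d) m ^ (d ∸ 1))}
      (Coprime-C (ℤ.- (ℤ.-1ℤ ℤ.^ m) , sign≢0 m , Pr.refl))
      (coprime-num-^ {pochF (+ d) m} (d ∸ 1) (coprime-pochF m m<n))

    closedForm : Fraction
    closedForm = closedNum ⊗ invert closedDen coprime-closedDen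

    frac-closedForm : frac closedForm ≡ rhs d n m e
    frac-closedForm = ≡.cong₂ (λ x y → (oneMinusQ (+ 1) *ᵣ oneMinusQ (+ (d ∸ 1)) *ᵣ x *ᵣ polyᵣ (X^ e))
        *ᵣ invᵣ (polyᵣ (constₚ (ℤ.- (ℤ.-1ℤ ℤ.^ m))) *ᵣ y))
      (frac-pochF (+ d) (n ∸ 1 ∸ m)) (frac-^ (pochF (+ d) m) (d ∸ 1) (frac-pochF (+ d) m))

    sum≃closedForm : Σ< n summand ≃ closedForm
    sum≃closedForm = divide (Σ< n summand) closedNum closedDen coprime-closedDen (F.trans
      (F.*-congˡ {x = Σ< n summand} (F.*-congˡ {x = ⊖ signF m} (^-congˡ (suc (suc j)) (pochF≃ (+ d) m))))
      (F.trans (evaluation summand e h (⊖ signF m) summand-eq 2[e+1] d≡2h (F.-‿cong (signF≃ m)))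
        (F.*-congʳ {x = E (+ e)} (F.*-cong
          (F.*-cong (F.sym (oneMinusF≃ (+ 1))) (F.sym (oneMinusF≃ (+ suc (suc j)))))
          (F.trans (F.sym (pochF≃ (+ d) N)) (F.reflexive (≡.cong (pochF (+ d)) (≡.sym n-1-m≡N))))))))

    congruence : lhs d n ≡ᵣ rhs d n m e [mod φ *ₚ φ ]
    congruence = ≡.subst₂ (λ x y → x ≡ᵣ y [mod φ *ₚ φ ]) (frac-Σ< n frac-summand) frac-closedForm (explicit (≃⇒∣ sum≃closedForm))
      where
      explicit : ∃[ U ] ∃[ V ] (Coprime V (φ *ₚ φ) ×
        ((num (Σ< n summand) *ₚ den closedForm -ₚ num closedForm *ₚ den (Σ< n summand)) *ₚ V
          ≋ (φ *ₚ φ *ₚ den (Σ< n summand) *ₚ den closedForm) *ₚ U)) →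
        frac (Σ< n summand) ≡ᵣ frac closedForm [mod φ *ₚ φ ]
      -- `c` is a polynomial equal to the constant k; `CoprimeP` asks for the integer k itself.
      explicit (U , V , (S , T , c , (k , k≢0 , c≋k) , bézout) , eq) =
        U , V , (S , T , k , k≢0 , at (Pr.trans bézout c≋k)) , at eq

-- The exponent of q and the final theorem

open import Data.Nat using (NonZero; _+_; _*_; _^_; _/_; _≤_)

-- With n + 1 = m d the difference is m d² (d-1)(m+1), which is 2d times the right-hand side. So
-- neither the truncated subtraction nor the two integer divisions lose anything.
exponent : ∀ d n m h j .{{_ : NonZero d}} → d ≡ 3 + j → d ≡ h * 2 → n + 1 ≡ m * d →
  (d * (d + n) * (n + 1) ∸ (n + 1) ^ 2) / 2 / d ≡ h * m * (2 + j) * suc m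
exponent d n m h j d≡3+j d≡h2 n+1≡md = begin
  (d * (d + n) * (n + 1) ∸ (n + 1) ^ 2) / 2 / d      ≡⟨ ≡.cong (λ x → (x ∸ (n + 1) ^ 2) / 2 / d) expansion ⟩
  (Y * d * 2 + (n + 1) ^ 2 ∸ (n + 1) ^ 2) / 2 / d    ≡⟨ ≡.cong (λ x → x / 2 / d) (ℕₚ.m+n∸n≡m (Y * d * 2) ((n + 1) ^ 2)) ⟩
  Y * d * 2 / 2 / d                                  ≡⟨ ≡.cong (_/ d) (m*n/n≡m (Y * d) 2) ⟩
  Y * d / d                                          ≡⟨ m*n/n≡m Y d ⟩
  Y                                                  ∎
  where
  Y = h * m * (2 + j) * suc m
  sum : d + n ≡ 2 + j + m * d
  sum = begin
    d + n               ≡⟨ ≡.cong (_+ n) d≡3+j ⟩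
    3 + j + n           ≡⟨ identity j n ⟩
    2 + j + (n + 1)     ≡⟨ ≡.cong (λ x → 2 + j + x) n+1≡md ⟩
    2 + j + m * d       ∎
    where
    identity : ∀ j n → 3 + j + n ≡ 2 + j + (n + 1)
    identity = solve-∀ℕ
  expansion : d * (d + n) * (n + 1) ≡ Y * d * 2 + (n + 1) ^ 2
  expansion = begin
    d * (d + n) * (n + 1)                               ≡⟨ ≡.cong₂ (λ x y → d * x * y) sum n+1≡md ⟩
    d * (2 + j + m * d) * (m * d)                       ≡⟨ identity₁ d m j ⟩
    -- Only the last d is split, as (2 + j) + 1: the 1 yields the square that is subtracted, and the
    -- rest joins the first summand.
    d * (m * (2 + j) * d) + m * d * (m * d) * d         ≡⟨ ≡.cong (λ x → d * (m * (2 + j) * d) + m * d * (m * d) * x) d≡3+j ⟩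
    d * (m * (2 + j) * d) + m * d * (m * d) * (3 + j)   ≡⟨ identity₂ d m j ⟩
    d * (m * (2 + j) * suc m * d) + (m * d) ^ 2         ≡⟨ ≡.cong (λ x → x * (m * (2 + j) * suc m * d) + (m * d) ^ 2) d≡h2 ⟩
    h * 2 * (m * (2 + j) * suc m * d) + (m * d) ^ 2     ≡⟨ identity₃ d m j h ⟩
    Y * d * 2 + (m * d) ^ 2                             ≡⟨ ≡.cong (λ x → Y * d * 2 + x ^ 2) n+1≡md ⟨
    Y * d * 2 + (n + 1) ^ 2                             ∎
    where
    identity₁ : ∀ d m j → d * (2 + j + m * d) * (m * d) ≡ d * (m * (2 + j) * d) + m * d * (m * d) * d
    identity₁ = solve-∀ℕ
    identity₂ : ∀ d m j → d * (m * (2 + j) * d) + m * d * (m * d) * (3 + j) ≡ d * (m * (2 + j) * suc m * d) + m * d * (m * d * 1)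
    identity₂ = solve-∀ℕ
    identity₃ : ∀ d m j h → h * 2 * (m * (2 + j) * suc m * d) + m * d * (m * d * 1) ≡ h * m * (2 + j) * suc m * d * 2 + m * d * (m * d * 1)
    identity₃ = solve-∀ℕ

congruence-Φ : ∀ j μ i h e → suc (suc i) ≡ (3 + j) * (2 + μ) → 3 + j ≡ 2 * h →
  suc e + suc e ≡ (3 + j) * (2 + j) * (2 + μ) * (3 + μ) →
  lhs (3 + j) (suc i) ≡ᵣ rhs (3 + j) (suc i) (2 + μ) e [mod Φ (suc i) *ₚ Φ (suc i) ]
congruence-Φ j μ i h e = Congruence.congruence (suc i) (Φ (suc i)) (divisorProduct (suc i) i)
  (factors exact-division i) (coprime-X-Φ exact-division i) (coprime-Φ-ρ exact-division i) j μ h e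

theorem1p1 : (d n : ℕ) .{{_ : NonZero d}} →
    4 ≤ d → 2 ∣ d → d ∣ n + 1 → 2 * d ∸ 1 ≤ n →
    lhs d n ≡ᵣ rhs d n ((n + 1) / d) ((d * (d + n) * (n + 1) ∸ (n + 1) ^ 2) / 2 / d ∸ 1)
    [mod Φ n *ₚ Φ n ]
-- Here d = 4 + j, so `suc j` takes the place of the earlier parameter d - 3.
theorem1p1 d n (s≤s (s≤s (s≤s (s≤s {n = j} z≤n)))) (divides h d≡h2) (divides m n+1≡md) 2d-1≤n =
  cases m n n+1≡md 2d-1≤n
  where
  Claim : ℕ → Set
  Claim n = lhs d n ≡ᵣ rhs d n ((n + 1) / d) ((d * (d + n) * (n + 1) ∸ (n + 1) ^ 2) / 2 / d ∸ 1) [mod Φ n *ₚ Φ n ]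
  cases : ∀ m n → n + 1 ≡ m * d → 2 * d ∸ 1 ≤ n → Claim n
  cases m             zero    _  ()
  cases zero          (suc i) () _
  -- m = 1 would mean n = d - 1, which is below 2d - 1.
  cases (suc zero)    (suc i) n+1≡d 2d-1≤n = contradiction d<n+1 (ℕₚ.≤⇒≯ (ℕₚ.≤-reflexive (≡.trans n+1≡d (ℕₚ.*-identityˡ d))))
    where
    d<n+1 : suc d ≤ suc i + 1
    d<n+1 = ≡.subst (suc d ≤_) (ℕₚ.+-comm 1 (suc i))
      (s≤s (ℕₚ.≤-trans (ℕₚ.m≤m+n d 0) (ℕₚ.≤-trans (ℕₚ.m≤n+m (d + 0) (3 + j)) 2d-1≤n)))
  cases m@(suc (suc μ)) (suc i) n+1≡md _ =
    ≡.subst₂ (λ x y → lhs d (suc i) ≡ᵣ rhs d (suc i) x y [mod Φ (suc i) *ₚ Φ (suc i) ])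
      (≡.sym (≡.trans (≡.cong (_/ d) n+1≡md) (m*n/n≡m m d)))
      (≡.sym (≡.cong (_∸ 1) (exponent d (suc i) m h (suc j) ≡.refl d≡h2 n+1≡md)))
      (congruence-Φ (suc j) μ i h (Y ∸ 1)
        (≡.trans (ℕₚ.+-comm 1 (suc i)) (≡.trans n+1≡md (ℕₚ.*-comm m d)))
        (≡.trans d≡h2 (ℕₚ.*-comm h 2)) doubled)
    where
    Y = h * m * (3 + j) * suc m
    -- As d > 0, h is positive and so is Y; the final -1 of the exponent is a genuine subtraction.
    positive : ∀ h → d ≡ h * 2 → suc (h * m * (3 + j) * suc m ∸ 1) ≡ h * m * (3 + j) * suc m
    positive zero    ()
    positive (suc h) _ = ≡.refl
    identity : ∀ h m j → h * m * (3 + j) * suc m + h * m * (3 + j) * suc m ≡ h * 2 * (3 + j) * m * suc m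
    identity = solve-∀ℕ
    doubled : suc (Y ∸ 1) + suc (Y ∸ 1) ≡ d * (3 + j) * m * suc m
    doubled = begin
      suc (Y ∸ 1) + suc (Y ∸ 1)          ≡⟨ ≡.cong₂ _+_ (positive h d≡h2) (positive h d≡h2) ⟩
      Y + Y                              ≡⟨ identity h m j ⟩
      h * 2 * (3 + j) * m * suc m        ≡⟨ ≡.cong (λ x → x * (3 + j) * m * suc m) d≡h2 ⟨
      d * (3 + j) * m * suc m            ∎
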